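{- Let $k\geq 16$ be a positive integer. Let $A$ be a finite set of $k$ integers such that $\min(A)=0$, $\gcd(A)=1$, and $|4^{\wedge}A| = 4k-12$. Then $A=[0,k+2]\setminus\{x,y,z\}$, where $\{x,y,z\}$ is one of the sets $\{1,2,3\}$, $\{k-1,k,k+1\}$, $\{1,2,k+1\}$, $\{1,k,k+1\}$, $\{1,3,k+2\}$, $\{k-2,k,k+2\}$, $\{2,k,k+2\}$, $\{1,k-1,k+2\}$, $\{3,k+1,k+2\}$, $\{k-3,k+1,k+2\}$, $\{4,k+1,k+2\}$, $\{k-4,k+1,k+2\}$.
   Context: For a finite set $A$ of integers and a positive integer $h\le |A|$, the restricted $h$-fold sumset $h^{\wedge}A$ is the set of all sums of $h$ distinct elements of $A$. For integers $\alpha\le\beta$, $[\alpha,\beta]=\{x\in\mathbb{Z}:\alpha\le x\le\beta\}$. $\gcd(A)$ denotes the greatest common divisor of the elements of $A$. -}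

module Defs where

open import Data.Nat as ℕ using (ℕ)
open import Data.Integer using (ℤ; +_; _+_; _-_; _≤_; 0ℤ; 1ℤ)
open import Data.Integer.GCD using (gcd)
open import Data.List using (List; []; _∷_; foldr; length)
open import Data.List.Membership.Propositional using (_∈_; _∉_)
open import Data.List.Relation.Unary.Unique.Propositional using (Unique)
open import Data.Product using (_×_; ∃; ∃-syntax)
open import Relation.Binary.PropositionalEquality using (_≡_; _≢_)
open import Relation.Nullary using (¬_)
open import Function.Bundles using (_⇔_)

-- A finite set of integers is represented by a duplicate-free list.

gcdL : List ℤ → ℤ
gcdL = foldr gcd 0ℤ

In4Sumset : List ℤ → ℤ → Set
In4Sumset A s = ∃[ a ] ∃[ b ] ∃[ c ] ∃[ d ]
  (a ∈ A × b ∈ A × c ∈ A × d ∈ A ×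
   a ≢ b × a ≢ c × a ≢ d × b ≢ c × b ≢ d × c ≢ d ×
   s ≡ a + b + c + d)

Card4Sumset : List ℤ → ℕ → Set
Card4Sumset A n = ∃[ S ] (Unique S × (∀ s → s ∈ S ⇔ In4Sumset A s) × length S ≡ n)

MinIsZero : List ℤ → Set
MinIsZero A = 0ℤ ∈ A × (∀ a → a ∈ A → 0ℤ ≤ a)

triples : ℕ → List (List ℤ)
triples k =
  (+ 1 ∷ + 2 ∷ + 3 ∷ []) ∷
  (K - + 1 ∷ K ∷ K + + 1 ∷ []) ∷
  (+ 1 ∷ + 2 ∷ K + + 1 ∷ []) ∷
  (+ 1 ∷ K ∷ K + + 1 ∷ []) ∷
  (+ 1 ∷ + 3 ∷ K + + 2 ∷ []) ∷
  (K - + 2 ∷ K ∷ K + + 2 ∷ []) ∷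
  (+ 2 ∷ K ∷ K + + 2 ∷ []) ∷
  (+ 1 ∷ K - + 1 ∷ K + + 2 ∷ []) ∷
  (+ 3 ∷ K + + 1 ∷ K + + 2 ∷ []) ∷
  (K - + 3 ∷ K + + 1 ∷ K + + 2 ∷ []) ∷
  (+ 4 ∷ K + + 1 ∷ K + + 2 ∷ []) ∷
  (K - + 4 ∷ K + + 1 ∷ K + + 2 ∷ []) ∷ []
  where K = + k

IsIntervalMinus : ℕ → List ℤ → List ℤ → Set
IsIntervalMinus k A T = ∀ n → n ∈ A ⇔ ((0ℤ ≤ n × n ≤ + k + + 2) × n ∉ T)

{-# OPTIONS --safe #-}

-- Along a saturated chain of 4-subsets of the sorted set A the sums increase strictly, which gives 4k - 15 of them;
-- here at most three further sums are allowed. If gaps p and q differ, a square in which one index crosses gap p and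
-- another crosses gap q contributes an extra sum, and squares occupying disjoint stretches of a chain add up. Four
-- such squares fit in if two inner gaps differ (each of the four indices crosses each inner gap once), so all gaps but
-- the first and last four are equal to some d. Letting one index cross an end gap while another runs through the inner
-- progression shows that the end gaps are d, 2d, 3d or 4d, whence d = 1 because gcd A = 1. What remains is finite: the
-- numbers of extra sums of the first and the last ten elements are computed for all patterns of four end gaps, they
-- add up to at most 3, and they cannot be so small that 4^A lies in an interval of fewer than 4k - 12 integers.
module Submission where

open import Defs
open import Data.Bool using (if_then_else_)
open import Data.Empty using (⊥; ⊥-elim)
open import Data.Integer as ℤ using (ℤ; +_; -_; _+_; _-_; _*_; _≤_; _<_; 0ℤ; 1ℤ)
import Data.Integer.Divisibility as ℤᵘ
import Data.Integer.Divisibility.Signed as ℤˢ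
open import Data.Integer.GCD using (gcd-greatest)
import Data.Integer.Properties as ℤ
import Data.Integer.Tactic.RingSolver as ℤ-Ring
open import Data.List using (List; []; _∷_; _++_; length; map; concatMap; upTo; downFrom; filter; reverse; foldr)
open import Data.List.Membership.DecPropositional using () renaming (_∈?_ to member?)
open import Data.List.Membership.Propositional using (_∈_; _∉_)
open import Data.List.Membership.Propositional.Properties
  using (∈-∃++; ∈-++⁺ˡ; ∈-++⁺ʳ; ∈-++⁻; ∈-map⁺; ∈-map⁻; ∈-filter⁺; ∈-filter⁻; ∈-upTo⁺; ∈-upTo⁻; ∈-downFrom⁺; ∈-downFrom⁻)
open import Data.List.Properties using (length-map; length-upTo; length-++-sucʳ)
open import Data.List.Relation.Binary.Permutation.Propositional using (_↭_; ↭-sym; ↭⇒↭ₛ)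
open import Data.List.Relation.Binary.Permutation.Propositional.Properties using (∈-resp-↭; ↭-length; ↭-reverse)
import Data.List.Relation.Binary.Permutation.Setoid.Properties as ↭ₛ
open import Data.List.Relation.Unary.All as All using (All; []; _∷_; all?)
open import Data.List.Relation.Unary.AllPairs as AllPairs using (AllPairs; []; _∷_)
open import Data.List.Relation.Unary.Any using (Any; any?; here; there)
open import Data.List.Relation.Unary.Sorted.TotalOrder.Properties using (Sorted⇒AllPairs)
open import Data.List.Relation.Unary.Unique.Propositional using (Unique)
open import Data.List.Sort ℤ.≤-decTotalOrder using (sort; sort-↭; sort-↗)
open import Data.Nat as ℕ using (ℕ; zero; suc; z≤n; s≤s; _∸_)
open import Data.Nat.Divisibility using (_∣0; ∣1⇒≡1)
import Data.Nat.Properties as ℕ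
import Data.Nat.Tactic.RingSolver as ℕ-Ring
open import Data.Product using (_×_; _,_; ∃-syntax; proj₁; proj₂)
open import Data.Product.Properties using (≡-dec)
open import Data.Sum using (_⊎_; inj₁; inj₂)
open import Function.Bundles using (Equivalence; mk⇔)
open import Relation.Binary.Definitions using (DecidableEquality; tri<; tri≈; tri>)
open import Relation.Binary.PropositionalEquality
  using (_≡_; _≢_; refl; sym; trans; cong; cong₂; subst; subst₂; module ≡-Reasoning)
open import Relation.Binary.PropositionalEquality.Properties using (setoid)
open import Relation.Nullary using (Dec; yes; no; does; ¬?; from-yes; _×-dec_; _⊎-dec_)
open import Relation.Nullary.Decidable using (map′; toWitness)
open import Relation.Unary using (Decidable)
open import Algebra.Properties.AbelianGroup ℤ.+-0-abelianGroup using (∙-cancelˡ)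

-- Strictly increasing chains of integers.

data Path (P : ℤ → Set) : ℕ → ℤ → ℤ → Set where
  stop : ∀ {s} → P s → Path P 0 s s
  step : ∀ {n s t u} → P s → s < t → Path P n t u → Path P (suc n) s u

infixr 5 _++ᴾ_

_++ᴾ_ : ∀ {P n m s t u} → Path P n s t → Path P m t u → Path P (n ℕ.+ m) s u
stop _        ++ᴾ q = q
step ps s<t p ++ᴾ q = step ps s<t (p ++ᴾ q)

start : ∀ {P n s t} → Path P n s t → P s
start (stop ps)     = ps
start (step ps _ _) = ps

end : ∀ {P n s t} → Path P n s t → P t
end (stop ps)    = ps
end (step _ _ p) = end p

-- Negation turns a chain around; with it, results on the small end of a set carry over to the large
-- end.
map⁻ : ∀ {P Q : ℤ → Set} → (∀ {s} → P s → Q (- s)) →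
       ∀ {n s t} → Path P n s t → Path Q n (- t) (- s)
map⁻ g (stop ps) = stop (g ps)
map⁻ {Q = Q} g {suc n} {s} {t} (step ps s<t p) =
  subst (λ m → Path Q m (- t) (- s)) (ℕ.+-comm n 1)
    (map⁻ g p ++ᴾ step (g (start p)) (ℤ.neg-mono-< s<t) (stop (g ps)))

-- Index quadruples, their ranks, and chains of their sums.

infix 4 _≤ᵠ_

record Quad : Set where
  constructor quad
  field i j l m : ℕ

open Quad

sum : (ℕ → ℤ) → Quad → ℤ
sum a (quad i j l m) = a i + a j + a l + a m

rank : Quad → ℕ
rank (quad i j l m) = i ℕ.+ j ℕ.+ l ℕ.+ m

record Valid (k : ℕ) (u : Quad) : Set where
  constructor valid
  field
    i<j : i u ℕ.< j u
    j<l : j u ℕ.< l u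
    l<m : l u ℕ.< m u
    m<k : m u ℕ.< k

record _≤ᵠ_ (u v : Quad) : Set where
  constructor le
  field
    i≤i : i u ℕ.≤ i v
    j≤j : j u ℕ.≤ j v
    l≤l : l u ℕ.≤ l v
    m≤m : m u ℕ.≤ m v

Sum4 : ℕ → (ℕ → ℤ) → ℤ → Set
Sum4 k a s = ∃[ u ] (Valid k u × s ≡ sum a u)

-- A saturated chain of quadruples makes one step per unit of rank; e is the number of steps beyond that.
record Gain (k : ℕ) (a : ℕ → ℤ) (e : ℕ) (u v : Quad) : Set where
  constructor gain
  field
    {steps} : ℕ
    path    : Path (Sum4 k a) steps (sum a u) (sum a v)
    excess  : steps ℕ.+ rank u ≡ rank v ℕ.+ e

Mono : ℕ → (ℕ → ℤ) → Set
Mono k a = ∀ {i} → suc i ℕ.< k → a i < a (suc i)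

module _ {k : ℕ} {a : ℕ → ℤ} where

  _⊕_ : ∀ {e e′ u v w} → Gain k a e u v → Gain k a e′ v w → Gain k a (e ℕ.+ e′) u w
  _⊕_ {e} {e′} {u} {v} {w} (gain {n} p x) (gain {n′} q y) = gain (p ++ᴾ q) (begin
    n ℕ.+ n′ ℕ.+ rank u       ≡⟨ eq₁ n n′ (rank u) ⟩
    n′ ℕ.+ (n ℕ.+ rank u)     ≡⟨ cong (n′ ℕ.+_) x ⟩
    n′ ℕ.+ (rank v ℕ.+ e)     ≡⟨ ℕ.+-assoc n′ _ e ⟨
    n′ ℕ.+ rank v ℕ.+ e       ≡⟨ cong (ℕ._+ e) y ⟩
    rank w ℕ.+ e′ ℕ.+ e       ≡⟨ eq₂ (rank w) e′ e ⟩
    rank w ℕ.+ (e ℕ.+ e′)     ∎)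
    where
    open ≡-Reasoning
    eq₁ : ∀ x y z → x ℕ.+ y ℕ.+ z ≡ y ℕ.+ (x ℕ.+ z)
    eq₁ = ℕ-Ring.solve-∀
    eq₂ : ∀ x y z → x ℕ.+ y ℕ.+ z ≡ x ℕ.+ (z ℕ.+ y)
    eq₂ = ℕ-Ring.solve-∀

  nil : ∀ {u} → Valid k u → Gain k a 0 u u
  nil {u} v = gain (stop (u , v , refl)) (sym (ℕ.+-identityʳ _))

  bump : ∀ {u v} → Valid k u → Valid k v → sum a u < sum a v → rank v ≡ suc (rank u) → Gain k a 0 u v
  bump {u} {v} vu vv u<v r =
    gain (step (u , vu , refl) u<v (stop (v , vv , refl))) (trans (sym r) (sym (ℕ.+-identityʳ _)))

  run : (U : ℕ → Quad) → ∀ {x y} → x ℕ.≤ y →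
        (∀ {z} → x ℕ.≤ z → z ℕ.≤ y → Valid k (U z)) →
        (∀ {z} → z ℕ.< y → sum a (U z) < sum a (U (suc z))) →
        (∀ z → rank (U (suc z)) ≡ suc (rank (U z))) →
        Gain k a 0 (U x) (U y)
  run U {x} {y} x≤y val inc rk = go (ℕ.≤⇒≤′ x≤y) ℕ.≤-refl
    where
    go : ∀ {z} → x ℕ.≤′ z → z ℕ.≤ y → Gain k a 0 (U x) (U z)
    go ℕ.≤′-refl z≤y = nil (val ℕ.≤-refl z≤y)
    go (ℕ.≤′-step x≤z) z≤y =
      go x≤z (ℕ.<⇒≤ z≤y) ⊕
      bump (val (ℕ.≤′⇒≤ x≤z) (ℕ.<⇒≤ z≤y)) (val (ℕ.m≤n⇒m≤1+n (ℕ.≤′⇒≤ x≤z)) z≤y) (inc z≤y) (rk _)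

  module _ (mono : Mono k a) where

    -- Raising the largest index first and then the others in descending order keeps the four
    -- indices distinct, and every unit move increases the sum.
    climb : ∀ {u v} → Valid k u → Valid k v → u ≤ᵠ v → Gain k a 0 u v
    climb {quad i j l m} {quad i′ j′ l′ m′} (valid i<j j<l l<m m<k) (valid i<j′ j<l′ l<m′ m<k′) (le i≤ j≤ l≤ m≤) =
      ((run (λ z → quad i j l z) m≤
             (λ x≤z z≤y → valid i<j j<l (ℕ.<-≤-trans l<m x≤z) (ℕ.≤-<-trans z≤y m<k′))
             (λ z<y → ℤ.+-monoʳ-< (a i + a j + a l) (mono (ℕ.≤-<-trans z<y m<k′)))
             (λ z → eq₄ i j l z)
       ⊕ run (λ z → quad i j z m′) l≤
             (λ x≤z z≤y → valid i<j (ℕ.<-≤-trans j<l x≤z) (ℕ.≤-<-trans z≤y l<m′) m<k′)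
             (λ z<y → ℤ.+-monoˡ-< (a m′) (ℤ.+-monoʳ-< (a i + a j) (mono (ℕ.≤-<-trans z<y l<k))))
             (λ z → eq₃ i j z m′))
       ⊕ run (λ z → quad i z l′ m′) j≤
             (λ x≤z z≤y → valid (ℕ.<-≤-trans i<j x≤z) (ℕ.≤-<-trans z≤y j<l′) l<m′ m<k′)
             (λ z<y → ℤ.+-monoˡ-< (a m′) (ℤ.+-monoˡ-< (a l′) (ℤ.+-monoʳ-< (a i) (mono (ℕ.≤-<-trans z<y j<k)))))
             (λ z → eq₂ i z l′ m′))
       ⊕ run (λ z → quad z j′ l′ m′) i≤
             (λ x≤z z≤y → valid (ℕ.≤-<-trans z≤y i<j′) j<l′ l<m′ m<k′)
             (λ z<y → ℤ.+-monoˡ-< (a m′) (ℤ.+-monoˡ-< (a l′) (ℤ.+-monoˡ-< (a j′) (mono (ℕ.≤-<-trans z<y i<k)))))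
             (λ z → refl)
      where
      l<k = ℕ.<-trans l<m′ m<k′
      j<k = ℕ.<-trans j<l′ l<k
      i<k = ℕ.<-trans i<j′ j<k
      eq₄ : ∀ i j l z → i ℕ.+ j ℕ.+ l ℕ.+ suc z ≡ suc (i ℕ.+ j ℕ.+ l ℕ.+ z)
      eq₄ = ℕ-Ring.solve-∀
      eq₃ : ∀ i j z l → i ℕ.+ j ℕ.+ suc z ℕ.+ l ≡ suc (i ℕ.+ j ℕ.+ z ℕ.+ l)
      eq₃ = ℕ-Ring.solve-∀
      eq₂ : ∀ i z j l → i ℕ.+ suc z ℕ.+ j ℕ.+ l ≡ suc (i ℕ.+ z ℕ.+ j ℕ.+ l)
      eq₂ = ℕ-Ring.solve-∀

  -- As their sums differ, both middle corners fit into one chain, in the order of their sums: three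
  -- steps for two units of rank.
  diamond : ∀ {u p q v} → Valid k u → Valid k p → Valid k q → Valid k v →
            sum a u < sum a p → sum a u < sum a q → sum a p < sum a v → sum a q < sum a v →
            sum a p ≢ sum a q → rank v ≡ 2 ℕ.+ rank u → Gain k a 1 u v
  diamond {u} {p} {q} {v} vu vp vq vv u<p u<q p<v q<v p≢q r = gain path (trans (sym (cong suc r)) (sym (ℕ.+-comm _ 1)))
    where
    path : Path (Sum4 k a) 3 (sum a u) (sum a v)
    path with ℤ.<-cmp (sum a p) (sum a q)
    ... | tri< p<q _ _ =
      step (u , vu , refl) u<p (step (p , vp , refl) p<q (step (q , vq , refl) q<v (stop (v , vv , refl))))
    ... | tri≈ _ p≡q _ = ⊥-elim (p≢q p≡q)
    ... | tri> _ _ q<p =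
      step (u , vu , refl) u<q (step (q , vq , refl) q<p (step (p , vp , refl) p<v (stop (v , vv , refl))))

bottom : Quad
bottom = quad 0 1 2 3

top : ℕ → Quad
top r = quad r (1 ℕ.+ r) (2 ℕ.+ r) (3 ℕ.+ r)

valid-bottom : ∀ {r} → Valid (4 ℕ.+ r) bottom
valid-bottom = valid (from-yes (0 ℕ.<? 1)) (from-yes (1 ℕ.<? 2)) (from-yes (2 ℕ.<? 3)) (ℕ.m≤m+n 4 _)

valid-top : ∀ {r} → Valid (4 ℕ.+ r) (top r)
valid-top = valid ℕ.≤-refl ℕ.≤-refl ℕ.≤-refl ℕ.≤-refl

bottom≤ : ∀ {k u} → Valid k u → bottom ≤ᵠ u
bottom≤ (valid i<j j<l l<m _) = le z≤n 1≤j 2≤l 3≤m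
  where
  1≤j = ℕ.≤-<-trans z≤n i<j
  2≤l = ℕ.≤-<-trans 1≤j j<l
  3≤m = ℕ.≤-<-trans 2≤l l<m

≤top : ∀ {r u} → Valid (4 ℕ.+ r) u → u ≤ᵠ top r
≤top (valid i<j j<l l<m (s≤s m≤)) = le i≤ j≤ l≤ m≤
  where
  l≤ = ℕ.≤-pred (ℕ.≤-trans l<m m≤)
  j≤ = ℕ.≤-pred (ℕ.≤-trans j<l l≤)
  i≤ = ℕ.≤-pred (ℕ.≤-trans i<j j≤)

-- Squares in which two neighbouring indices cross two different gaps.

module _ {k : ℕ} {a : ℕ → ℤ} (mono : Mono k a) where

  gap : ℕ → ℤ
  gap i = a (suc i) - a i

  -- The middle corners of the square exceed the lowest one by `gap p` and `gap q`, so they have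
  -- different sums. The bound `suc p < q` keeps the indices distinct whichever of the two moves
  -- first.
  cross₃₄ : ∀ {x y p q} → x ℕ.< y → y ℕ.< p → suc p ℕ.< q → suc q ℕ.< k → gap p ≢ gap q →
            Gain k a 1 (quad x y p q) (quad x y (suc p) (suc q))
  cross₃₄ {x} {y} {p} {q} x<y y<p p<q q<k p≢q =
    diamond (valid x<y y<p p<q′ q<k′) (valid x<y (ℕ.m≤n⇒m≤1+n y<p) p<q q<k′)
            (valid x<y y<p (ℕ.m≤n⇒m≤1+n p<q′) q<k)
            (valid x<y (ℕ.m≤n⇒m≤1+n y<p) (ℕ.m≤n⇒m≤1+n p<q) q<k)
            (ℤ.+-monoˡ-< (a q) (ℤ.+-monoʳ-< (a x + a y) (mono p<k)))
            (ℤ.+-monoʳ-< (a x + a y + a p) (mono q<k))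
            (ℤ.+-monoʳ-< (a x + a y + a (suc p)) (mono q<k))
            (ℤ.+-monoˡ-< (a (suc q)) (ℤ.+-monoʳ-< (a x + a y) (mono p<k)))
            (λ e → p≢q (trans (eq₁ (a x) (a y) (a p) (a (suc p)) (a q))
              (trans (cong (_- (a x + a y + a p + a q)) e)
                     (eq₂ (a x) (a y) (a p) (a q) (a (suc q))))))
            (eq₃ x y p q)
    where
    p<q′ = ℕ.<⇒≤ p<q
    q<k′ = ℕ.<⇒≤ q<k
    p<k = ℕ.<-trans p<q q<k′
    eq₁ : ∀ x y p p′ q → p′ - p ≡ x + y + p′ + q - (x + y + p + q)
    eq₁ = ℤ-Ring.solve-∀
    eq₂ : ∀ x y p q q′ → x + y + p + q′ - (x + y + p + q) ≡ q′ - q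
    eq₂ = ℤ-Ring.solve-∀
    eq₃ : ∀ x y p q → x ℕ.+ y ℕ.+ suc p ℕ.+ suc q ≡ 2 ℕ.+ (x ℕ.+ y ℕ.+ p ℕ.+ q)
    eq₃ = ℕ-Ring.solve-∀

  cross₂₃ : ∀ {x p q y} → x ℕ.< p → suc p ℕ.< q → suc q ℕ.< y → y ℕ.< k → gap p ≢ gap q →
            Gain k a 1 (quad x p q y) (quad x (suc p) (suc q) y)
  cross₂₃ {x} {p} {q} {y} x<p p<q q<y y<k p≢q =
    diamond (valid x<p p<q′ q<y′ y<k) (valid (ℕ.m≤n⇒m≤1+n x<p) p<q q<y′ y<k)
            (valid x<p (ℕ.m≤n⇒m≤1+n p<q′) q<y y<k) (valid (ℕ.m≤n⇒m≤1+n x<p) (ℕ.m≤n⇒m≤1+n p<q) q<y y<k)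
            (ℤ.+-monoˡ-< (a y) (ℤ.+-monoˡ-< (a q) (ℤ.+-monoʳ-< (a x) (mono p<k))))
            (ℤ.+-monoˡ-< (a y) (ℤ.+-monoʳ-< (a x + a p) (mono q<k)))
            (ℤ.+-monoˡ-< (a y) (ℤ.+-monoʳ-< (a x + a (suc p)) (mono q<k)))
            (ℤ.+-monoˡ-< (a y) (ℤ.+-monoˡ-< (a (suc q)) (ℤ.+-monoʳ-< (a x) (mono p<k))))
            (λ e → p≢q (trans (eq₁ (a x) (a p) (a (suc p)) (a q) (a y))
              (trans (cong (_- (a x + a p + a q + a y)) e)
                     (eq₂ (a x) (a p) (a q) (a (suc q)) (a y)))))
            (eq₃ x p q y)
    where
    p<q′ = ℕ.<⇒≤ p<q
    q<y′ = ℕ.<⇒≤ q<y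
    q<k = ℕ.<-trans q<y y<k
    p<k = ℕ.<-trans p<q (ℕ.<⇒≤ q<k)
    eq₁ : ∀ x p p′ q y → p′ - p ≡ x + p′ + q + y - (x + p + q + y)
    eq₁ = ℤ-Ring.solve-∀
    eq₂ : ∀ x p q q′ y → x + p + q′ + y - (x + p + q + y) ≡ q′ - q
    eq₂ = ℤ-Ring.solve-∀
    eq₃ : ∀ x p q y → x ℕ.+ suc p ℕ.+ suc q ℕ.+ y ≡ 2 ℕ.+ (x ℕ.+ p ℕ.+ q ℕ.+ y)
    eq₃ = ℕ-Ring.solve-∀

  cross₁₂ : ∀ {p q x y} → suc p ℕ.< q → suc q ℕ.< x → x ℕ.< y → y ℕ.< k → gap p ≢ gap q →
            Gain k a 1 (quad p q x y) (quad (suc p) (suc q) x y)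
  cross₁₂ {p} {q} {x} {y} p<q q<x x<y y<k p≢q =
    diamond (valid p<q′ q<x′ x<y y<k) (valid p<q q<x′ x<y y<k)
            (valid (ℕ.m≤n⇒m≤1+n p<q′) q<x x<y y<k) (valid (ℕ.m≤n⇒m≤1+n p<q) q<x x<y y<k)
            (ℤ.+-monoˡ-< (a y) (ℤ.+-monoˡ-< (a x) (ℤ.+-monoˡ-< (a q) (mono p<k))))
            (ℤ.+-monoˡ-< (a y) (ℤ.+-monoˡ-< (a x) (ℤ.+-monoʳ-< (a p) (mono q<k))))
            (ℤ.+-monoˡ-< (a y) (ℤ.+-monoˡ-< (a x) (ℤ.+-monoʳ-< (a (suc p)) (mono q<k))))
            (ℤ.+-monoˡ-< (a y) (ℤ.+-monoˡ-< (a x) (ℤ.+-monoˡ-< (a (suc q)) (mono p<k))))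
            (λ e → p≢q (trans (eq₁ (a p) (a (suc p)) (a q) (a x) (a y))
              (trans (cong (_- (a p + a q + a x + a y)) e)
                     (eq₂ (a p) (a q) (a (suc q)) (a x) (a y)))))
            (eq₃ p q x y)
    where
    p<q′ = ℕ.<⇒≤ p<q
    q<x′ = ℕ.<⇒≤ q<x
    q<k = ℕ.<-trans q<x (ℕ.<-trans x<y y<k)
    p<k = ℕ.<-trans p<q (ℕ.<⇒≤ q<k)
    eq₁ : ∀ p p′ q x y → p′ - p ≡ p′ + q + x + y - (p + q + x + y)
    eq₁ = ℤ-Ring.solve-∀
    eq₂ : ∀ p q q′ x y → p + q′ + x + y - (p + q + x + y) ≡ q′ - q
    eq₂ = ℤ-Ring.solve-∀
    eq₃ : ∀ p q x y → suc p ℕ.+ suc q ℕ.+ x ℕ.+ y ≡ 2 ℕ.+ (p ℕ.+ q ℕ.+ x ℕ.+ y)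
    eq₃ = ℕ-Ring.solve-∀

-- Equality of the inner gaps, and the possible end gaps.

one-to-four : List ℕ
one-to-four = 1 ∷ 2 ∷ 3 ∷ 4 ∷ []

module Ends (r : ℕ) (12≤r : 12 ℕ.≤ r) (a : ℕ → ℤ) (mono : Mono (4 ℕ.+ r) a)
            (small′ : ∀ {e} → Gain (4 ℕ.+ r) a e bottom (top r) → e ℕ.≤ 3) where

  k : ℕ
  k = 4 ℕ.+ r

  -- Saturated climbs below `u` and above `v` extend the chain to one from `bottom` to `top r`
  -- without changing its excess.
  small : ∀ {e u v} → Valid k u → Valid k v → Gain k a e u v → e ℕ.≤ 3
  small {e} vu vv g = subst (ℕ._≤ 3) (ℕ.+-identityʳ e)
    (small′ ((climb mono valid-bottom vu (bottom≤ vu) ⊕ g) ⊕ climb mono vv valid-top (≤top vv)))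

  Δ : ℕ → ℤ
  Δ = gap mono

  Δ-positive : ∀ {i} → suc i ℕ.< k → 0ℤ < Δ i
  Δ-positive {i} i<k = subst (_< Δ i) (ℤ.+-inverseʳ (a i)) (ℤ.+-monoˡ-< (- a i) (mono i<k))

  Inner : ℕ → Set
  Inner p = 4 ℕ.≤ p × 2 ℕ.+ p ℕ.≤ r

  -- Gap 2 lies below and gap r above all inner gaps, with just enough room for the other indices to wait aside.
  four-squares : ∀ {p q} → Inner p → Inner q → Δ 2 ≢ Δ p → Δ q ≢ Δ r → ⊥
  four-squares {p} {q} (4≤p , p+2≤r) (4≤q , q+2≤r) 2≢p q≢r = ℕ.<-irrefl refl (small v₁ v₈ total)
    where
    p+1≤r : suc p ℕ.≤ r
    p+1≤r = ℕ.<⇒≤ p+2≤r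
    p<r+4 : suc p ℕ.< 4 ℕ.+ r
    p<r+4 = ℕ.≤-trans p+2≤r (ℕ.m≤n+m r 4)
    p<r+3 : suc p ℕ.< 3 ℕ.+ r
    p<r+3 = ℕ.≤-trans p+2≤r (ℕ.m≤n+m r 3)
    p<r+2 : suc p ℕ.< 2 ℕ.+ r
    p<r+2 = ℕ.≤-trans p+2≤r (ℕ.m≤n+m r 2)
    2<p : 3 ℕ.≤ p
    2<p = ℕ.<⇒≤ 4≤p
    v₁ : Valid k (quad 0 1 2 p)
    v₁ = valid (s≤s z≤n) (s≤s (s≤s z≤n)) 2<p (ℕ.<⇒≤ p<r+4)
    v₂ : Valid k (quad 0 1 3 (suc p))
    v₂ = valid (s≤s z≤n) (s≤s (s≤s z≤n)) (ℕ.≤-trans 4≤p (ℕ.n≤1+n p)) p<r+4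
    v₃ : Valid k (quad 0 2 p (3 ℕ.+ r))
    v₃ = valid (s≤s z≤n) 2<p (ℕ.<⇒≤ p<r+3) ℕ.≤-refl
    v₄ : Valid k (quad 0 3 (suc p) (3 ℕ.+ r))
    v₄ = valid (s≤s z≤n) (ℕ.≤-trans 4≤p (ℕ.n≤1+n p)) p<r+3 ℕ.≤-refl
    v₅ : Valid k (quad 2 p (2 ℕ.+ r) (3 ℕ.+ r))
    v₅ = valid 2<p (ℕ.<⇒≤ p<r+2) ℕ.≤-refl ℕ.≤-refl
    v₆ : Valid k (quad 3 (suc p) (2 ℕ.+ r) (3 ℕ.+ r))
    v₆ = valid (ℕ.≤-trans 4≤p (ℕ.n≤1+n p)) p<r+2 ℕ.≤-refl ℕ.≤-refl
    v₇ : Valid k (quad q r (2 ℕ.+ r) (3 ℕ.+ r))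
    v₇ = valid (ℕ.<⇒≤ q+2≤r) (ℕ.n≤1+n _) ℕ.≤-refl ℕ.≤-refl
    v₈ : Valid k (quad (suc q) (suc r) (2 ℕ.+ r) (3 ℕ.+ r))
    v₈ = valid (ℕ.m≤n⇒m≤1+n q+2≤r) ℕ.≤-refl ℕ.≤-refl ℕ.≤-refl
    total : Gain k a 4 (quad 0 1 2 p) (quad (suc q) (suc r) (2 ℕ.+ r) (3 ℕ.+ r))
    total =
      -- Three squares pair gap 2 with gap `p`: they move the third and fourth index, then the
      -- second and third, then the first and second. The last square pairs gap `q` with gap `r`.
      -- Climbs connect them.
      (((((cross₃₄ mono (s≤s z≤n) (s≤s (s≤s z≤n)) 4≤p p<r+4 2≢p
      ⊕ climb mono v₂ v₃ (le z≤n (s≤s z≤n) 2<p (ℕ.<⇒≤ p<r+3)))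
      ⊕ cross₂₃ mono (s≤s z≤n) 4≤p p<r+3 ℕ.≤-refl 2≢p)
      ⊕ climb mono v₄ v₅ (le z≤n 2<p (ℕ.<⇒≤ p<r+2) ℕ.≤-refl))
      ⊕ cross₁₂ mono 4≤p p<r+2 ℕ.≤-refl ℕ.≤-refl 2≢p)
      ⊕ climb mono v₆ v₇ (le (ℕ.<⇒≤ 4≤q) p+1≤r ℕ.≤-refl ℕ.≤-refl))
      ⊕ cross₁₂ mono q+2≤r ℕ.≤-refl ℕ.≤-refl ℕ.≤-refl q≢r

  -- Two different inner gaps would leave one of them different from gap 2, and one different from gap r.
  inner-const : ∀ {i j} → Inner i → Inner j → Δ i ≡ Δ j
  inner-const {i} {j} ii ij with Δ i ℤ.≟ Δ j
  ... | yes e = e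
  ... | no i≢j with Δ 2 ℤ.≟ Δ i | Δ i ℤ.≟ Δ r
  ...   | yes 2≡i | yes i≡r = ⊥-elim (four-squares ij ij (λ e → i≢j (trans (sym 2≡i) e)) (λ e → i≢j (trans i≡r (sym e))))
  ...   | yes 2≡i | no i≢r  = ⊥-elim (four-squares ij ii (λ e → i≢j (trans (sym 2≡i) e)) i≢r)
  ...   | no 2≢i  | yes i≡r = ⊥-elim (four-squares ii ij 2≢i (λ e → i≢j (trans i≡r (sym e))))
  ...   | no 2≢i  | no i≢r  = ⊥-elim (four-squares ii ii 2≢i i≢r)

  d : ℤ
  d = Δ 4

  suc-gap : ∀ i → a (suc i) ≡ a i + Δ i
  suc-gap i = eq (a i) (a (suc i))
    where
    eq : ∀ x y → y ≡ x + (y - x)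
    eq = ℤ-Ring.solve-∀

  inner₄ : Inner 4
  inner₄ = ℕ.≤-refl , ℕ.≤-trans (from-yes (6 ℕ.≤? 12)) 12≤r

  inner-step : ∀ {p} → Inner p → a (suc p) ≡ a p + d
  inner-step {p} ip = trans (suc-gap p) (cong (λ z → a p + z) (inner-const ip inner₄))

  -- While the largest index runs through gaps 7 to 10, the smallest one stands before or after gap i. The ten sums
  -- x 0, …, x 4, y 0, …, y 4 are distinct unless gap i is a small multiple of d.
  module EndGap {i} (i<4 : i ℕ.< 4) where

    g : ℤ
    g = Δ i

    X Y : ℕ → Quad
    X t = quad i 5 6 (7 ℕ.+ t)
    Y t = quad (suc i) 5 6 (7 ℕ.+ t)

    x y : ℕ → ℤ
    x t = sum a (X t)
    y t = sum a (Y t)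

    <k : ∀ {t} → t ℕ.≤ 4 → 7 ℕ.+ t ℕ.< k
    <k t≤4 = ℕ.≤-trans (s≤s (ℕ.+-monoʳ-≤ 7 t≤4)) (ℕ.≤-trans 12≤r (ℕ.m≤n+m r 4))

    vX : ∀ {t} → t ℕ.≤ 4 → Valid k (X t)
    vX t≤4 = valid (ℕ.m≤n⇒m≤1+n i<4) (from-yes (5 ℕ.<? 6)) (ℕ.m≤m+n 7 _) (<k t≤4)

    vY : ∀ {t} → t ℕ.≤ 4 → Valid k (Y t)
    vY t≤4 = valid (s≤s i<4) (from-yes (5 ℕ.<? 6)) (ℕ.m≤m+n 7 _) (<k t≤4)

    xₜ : ∀ {t} → t ℕ.≤ 4 → x t ≡ x 0 + + t * d
    xₜ {zero}  _   = eq (x 0) d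
      where
      eq : ∀ s d → s ≡ s + + 0 * d
      eq = ℤ-Ring.solve-∀
    xₜ {suc t} t<4 = begin
      x (suc t)               ≡⟨ cong (λ z → a i + a 5 + a 6 + z) (inner-step inner) ⟩
      a i + a 5 + a 6 + (a (7 ℕ.+ t) + d)  ≡⟨ ℤ.+-assoc (a i + a 5 + a 6) (a (7 ℕ.+ t)) d ⟨
      x t + d                 ≡⟨ cong (_+ d) (xₜ (ℕ.<⇒≤ t<4)) ⟩
      x 0 + + t * d + d       ≡⟨ eq (x 0) (+ t) d ⟩
      x 0 + + suc t * d       ∎
      where
      open ≡-Reasoning
      -- The last gap used is gap 10, which is inner exactly because `12 ≤ r`.
      inner : Inner (7 ℕ.+ t)
      inner = ℕ.m≤m+n 4 _ , ℕ.≤-trans (ℕ.+-monoʳ-≤ 8 t<4) 12≤r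
      eq : ∀ s t d → s + t * d + d ≡ s + (+ 1 + t) * d
      eq = ℤ-Ring.solve-∀

    yₜ : ∀ t → y t ≡ x t + g
    yₜ t = eq (a i) (a (suc i)) (a 5) (a 6) (a (7 ℕ.+ t))
      where
      eq : ∀ z w b c e → w + b + c + e ≡ z + b + c + e + (w - z)
      eq = ℤ-Ring.solve-∀

    x+ : ∀ t m → t ℕ.+ m ℕ.≤ 4 → x (t ℕ.+ m) ≡ x t + + m * d
    x+ t m t+m≤4 = begin
      x (t ℕ.+ m)               ≡⟨ xₜ t+m≤4 ⟩
      x 0 + + (t ℕ.+ m) * d     ≡⟨ eq (x 0) (+ t) (+ m) d ⟩
      x 0 + + t * d + + m * d   ≡⟨ cong (λ z → z + + m * d) (xₜ (ℕ.m+n≤o⇒m≤o t t+m≤4)) ⟨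
      x t + + m * d             ∎
      where
      open ≡-Reasoning
      eq : ∀ s t m d → s + (t + m) * d ≡ s + t * d + m * d
      eq = ℤ-Ring.solve-∀

    x<y : ∀ {m} → + m * d < g → ∀ t → t ℕ.+ m ℕ.≤ 4 → x (t ℕ.+ m) < y t
    x<y {m} m<g t le₄ = subst₂ _<_ (sym (x+ t m le₄)) (sym (yₜ t)) (ℤ.+-monoʳ-< (x t) m<g)

    y<x : ∀ {m} → g < + m * d → ∀ t → t ℕ.+ m ℕ.≤ 4 → y t < x (t ℕ.+ m)
    y<x {m} g<m t le₄ = subst₂ _<_ (sym (yₜ t)) (sym (x+ t m le₄)) (ℤ.+-monoʳ-< (x t) g<m)

    x<x : ∀ t → suc t ℕ.≤ 4 → x t < x (suc t)
    x<x t t<4 = ℤ.+-monoʳ-< (a i + a 5 + a 6) (mono (<k t<4))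

    y<y : ∀ t → suc t ℕ.≤ 4 → y t < y (suc t)
    y<y t t<4 = ℤ.+-monoʳ-< (a (suc i) + a 5 + a 6) (mono (<k t<4))

    -- From `X 0` to `Y 4` the rank rises by 5 only, so a chain of nine steps has excess 4.
    too-long : Path (Sum4 k a) 9 (x 0) (y 4) → ⊥
    too-long p = ℕ.<-irrefl refl (small (vX z≤n) (vY ℕ.≤-refl) (gain p (eq i)))
      where
      eq : ∀ i → 9 ℕ.+ (i ℕ.+ 5 ℕ.+ 6 ℕ.+ 7) ≡ suc i ℕ.+ 5 ℕ.+ 6 ℕ.+ 11 ℕ.+ 4
      eq = ℕ-Ring.solve-∀

    sx : ∀ {n s} t → t ℕ.≤ 4 → x t < s → Path (Sum4 k a) n s (y 4) → Path (Sum4 k a) (suc n) (x t) (y 4)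
    sx t t≤4 = step (X t , vX t≤4 , refl)

    sy : ∀ {n s} t → t ℕ.≤ 4 → y t < s → Path (Sum4 k a) n s (y 4) → Path (Sum4 k a) (suc n) (y t) (y 4)
    sy t t≤4 = step (Y t , vY t≤4 , refl)

    y₄ : Path (Sum4 k a) 0 (y 4) (y 4)
    y₄ = stop (Y 4 , vY ℕ.≤-refl , refl)

    4≤4 : 4 ℕ.≤ 4
    4≤4 = ℕ.≤-refl
    3≤4 : 3 ℕ.≤ 4
    3≤4 = ℕ.n≤1+n 3
    2≤4 : 2 ℕ.≤ 4
    2≤4 = s≤s (s≤s z≤n)
    1≤4 : 1 ℕ.≤ 4
    1≤4 = s≤s z≤n

    -- In general, if `g` lies strictly between `m * d` and `(m + 1) * d`, then `y t` lies strictly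
    -- between `x (t + m)` and `x (t + m + 1)` as long as these exist. This fixes the order of all
    -- ten sums; the cases m = 0, 1, 2, 3 differ only in where the interleaving begins, and above
    -- `4 * d` all `x` precede all `y`.
    between₀ : + 0 * d < g → g < + 1 * d → ⊥
    between₀ l u = too-long
      (sx 0 z≤n (x<y l 0 z≤n) (sy 0 z≤n (y<x u 0 1≤4)
      (sx 1 1≤4 (x<y l 1 1≤4) (sy 1 1≤4 (y<x u 1 2≤4)
      (sx 2 2≤4 (x<y l 2 2≤4) (sy 2 2≤4 (y<x u 2 3≤4)
      (sx 3 3≤4 (x<y l 3 3≤4) (sy 3 3≤4 (y<x u 3 4≤4)
      (sx 4 4≤4 (x<y l 4 4≤4) y₄)))))))))

    between₁ : + 1 * d < g → g < + 2 * d → ⊥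
    between₁ l u = too-long
      (sx 0 z≤n (x<x 0 1≤4) (sx 1 1≤4 (x<y l 0 1≤4)
      (sy 0 z≤n (y<x u 0 2≤4) (sx 2 2≤4 (x<y l 1 2≤4)
      (sy 1 1≤4 (y<x u 1 3≤4) (sx 3 3≤4 (x<y l 2 3≤4)
      (sy 2 2≤4 (y<x u 2 4≤4) (sx 4 4≤4 (x<y l 3 4≤4)
      (sy 3 3≤4 (y<y 3 4≤4) y₄)))))))))

    between₂ : + 2 * d < g → g < + 3 * d → ⊥
    between₂ l u = too-long
      (sx 0 z≤n (x<x 0 1≤4) (sx 1 1≤4 (x<x 1 2≤4)
      (sx 2 2≤4 (x<y l 0 2≤4) (sy 0 z≤n (y<x u 0 3≤4)
      (sx 3 3≤4 (x<y l 1 3≤4) (sy 1 1≤4 (y<x u 1 4≤4)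
      (sx 4 4≤4 (x<y l 2 4≤4) (sy 2 2≤4 (y<y 2 3≤4)
      (sy 3 3≤4 (y<y 3 4≤4) y₄)))))))))

    between₃ : + 3 * d < g → g < + 4 * d → ⊥
    between₃ l u = too-long
      (sx 0 z≤n (x<x 0 1≤4) (sx 1 1≤4 (x<x 1 2≤4)
      (sx 2 2≤4 (x<x 2 3≤4) (sx 3 3≤4 (x<y l 0 3≤4)
      (sy 0 z≤n (y<x u 0 4≤4) (sx 4 4≤4 (x<y l 1 4≤4)
      (sy 1 1≤4 (y<y 1 2≤4) (sy 2 2≤4 (y<y 2 3≤4)
      (sy 3 3≤4 (y<y 3 4≤4) y₄)))))))))

    above₄ : + 4 * d < g → ⊥
    above₄ l = too-long
      (sx 0 z≤n (x<x 0 1≤4) (sx 1 1≤4 (x<x 1 2≤4)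
      (sx 2 2≤4 (x<x 2 3≤4) (sx 3 3≤4 (x<x 3 4≤4)
      (sx 4 4≤4 (x<y l 0 4≤4) (sy 0 z≤n (y<y 0 1≤4)
      (sy 1 1≤4 (y<y 1 2≤4) (sy 2 2≤4 (y<y 2 3≤4)
      (sy 3 3≤4 (y<y 3 4≤4) y₄)))))))))

    positive : + 0 * d < g
    positive = Δ-positive (ℕ.≤-trans (s≤s i<4) (ℕ.≤-trans (from-yes (5 ℕ.≤? 12)) (ℕ.≤-trans 12≤r (ℕ.m≤n+m r 4))))

    end-gap : ∃[ m ] (m ∈ one-to-four × g ≡ + m * d)
    end-gap with ℤ.<-cmp g (+ 1 * d)
    ... | tri< g<1 _ _ = ⊥-elim (between₀ positive g<1)
    ... | tri≈ _ g≡1 _ = 1 , here refl , g≡1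
    ... | tri> _ _ g>1 with ℤ.<-cmp g (+ 2 * d)
    ...   | tri< g<2 _ _ = ⊥-elim (between₁ g>1 g<2)
    ...   | tri≈ _ g≡2 _ = 2 , there (here refl) , g≡2
    ...   | tri> _ _ g>2 with ℤ.<-cmp g (+ 3 * d)
    ...     | tri< g<3 _ _ = ⊥-elim (between₂ g>2 g<3)
    ...     | tri≈ _ g≡3 _ = 3 , there (there (here refl)) , g≡3
    ...     | tri> _ _ g>3 with ℤ.<-cmp g (+ 4 * d)
    ...       | tri< g<4 _ _ = ⊥-elim (between₃ g>3 g<4)
    ...       | tri≈ _ g≡4 _ = 4 , there (there (there (here refl))) , g≡4
    ...       | tri> _ _ g>4 = ⊥-elim (above₄ g>4)

-- End shapes and their classification by computation.

-- The first four gaps, in units of the inner gap; coord gives the resulting positions.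
Shape : Set
Shape = ℕ × ℕ × ℕ × ℕ

coord : Shape → ℕ → ℕ
coord (p , q , s , t) 0 = 0
coord (p , q , s , t) 1 = p
coord (p , q , s , t) 2 = p ℕ.+ q
coord (p , q , s , t) 3 = p ℕ.+ q ℕ.+ s
coord (p , q , s , t) (suc (suc (suc (suc i)))) = p ℕ.+ q ℕ.+ s ℕ.+ t ℕ.+ i

sumℕ : (ℕ → ℕ) → Quad → ℕ
sumℕ c (quad i j l m) = c i ℕ.+ c j ℕ.+ c l ℕ.+ c m

range : ℕ → ℕ → List ℕ
range x y = map (x ℕ.+_) (upTo (y ∸ x))

quads : ℕ → List Quad
quads k =
  concatMap (λ i → concatMap (λ j → concatMap (λ l → map (quad i j l)
    (range (suc l) k)) (range (suc j) k)) (range (suc i) k)) (range 0 k)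

count : ∀ {Q : ℕ → Set} → Decidable Q → ℕ → ℕ → ℕ
count Q? lo zero    = 0
count Q? lo (suc n) = if does (Q? (lo ℕ.+ suc n)) then suc (count Q? lo n) else count Q? lo n

IsSum : List ℕ → ℕ → Set
IsSum sums t = Any (t ≡_) sums

isSum? : ∀ sums → Decidable (IsSum sums)
isSum? sums t = any? (t ℕ.≟_) sums

-- On the way from `bottom` to a quadruple beyond the end gaps, gap 0 is crossed by one index, gap 1
-- by two, gap 2 by three and gap 3 by all four.
weight : Shape → ℕ
weight (p , q , s , t) = p ℕ.+ 2 ℕ.* q ℕ.+ 3 ℕ.* s ℕ.+ 4 ℕ.* t

-- The least and the greatest sum of four of the first ten positions differ by suc (width s).
width : Shape → ℕ
width s = weight s ℕ.+ 13

opaque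
  windowQuads : List Quad
  windowQuads = quads 10

windowSums : Shape → List ℕ
windowSums s = map (sumℕ (coord s)) windowQuads

-- `count` sees only the sums strictly between the least and the greatest one; `suc` adds the final
-- step to the greatest.
steps : Shape → ℕ
steps s = suc (count (isSum? (windowSums s)) (sumℕ (coord s) bottom) (width s))

-- The rank is 6 at `bottom` and 30 at `top 6`, hence 24.
excess : Shape → ℕ
excess s = steps s ∸ 24

-- By `classify`, all other patterns of gaps from 1 to 4 have excess at least 4.
shapes : List Shape
shapes = (1 , 1 , 1 , 1) ∷ (2 , 1 , 1 , 1) ∷ (1 , 2 , 1 , 1) ∷ (3 , 1 , 1 , 1) ∷
         (4 , 1 , 1 , 1) ∷ (2 , 2 , 1 , 1) ∷ (1 , 1 , 2 , 1) ∷ (1 , 1 , 1 , 2) ∷ []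

-- The pairs of end shapes (the right one read from the right) that lead to the twelve sets of the theorem, in the same order.
shapePairs : List (Shape × Shape)
shapePairs =
  ((4 , 1 , 1 , 1) , (1 , 1 , 1 , 1)) ∷ ((1 , 1 , 1 , 1) , (4 , 1 , 1 , 1)) ∷
  ((3 , 1 , 1 , 1) , (2 , 1 , 1 , 1)) ∷ ((2 , 1 , 1 , 1) , (3 , 1 , 1 , 1)) ∷
  ((2 , 2 , 1 , 1) , (1 , 1 , 1 , 1)) ∷ ((1 , 1 , 1 , 1) , (2 , 2 , 1 , 1)) ∷
  ((1 , 2 , 1 , 1) , (2 , 1 , 1 , 1)) ∷ ((2 , 1 , 1 , 1) , (1 , 2 , 1 , 1)) ∷
  ((1 , 1 , 2 , 1) , (1 , 1 , 1 , 1)) ∷ ((1 , 1 , 1 , 1) , (1 , 1 , 2 , 1)) ∷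
  ((1 , 1 , 1 , 2) , (1 , 1 , 1 , 1)) ∷ ((1 , 1 , 1 , 1) , (1 , 1 , 1 , 2)) ∷ []

_≟ˢ_ : DecidableEquality Shape
_≟ˢ_ = ≡-dec ℕ._≟_ (≡-dec ℕ._≟_ (≡-dec ℕ._≟_ ℕ._≟_))

opaque
  unfolding windowQuads

  classify : All (λ p → All (λ q → All (λ s → All (λ t →
               (p , q , s , t) ∈ shapes ⊎ 28 ℕ.≤ steps (p , q , s , t))
               one-to-four) one-to-four) one-to-four) one-to-four
  classify = toWitness {a? = all? (λ p → all? (λ q → all? (λ s → all? (λ t →
               member? _≟ˢ_ (p , q , s , t) shapes ⊎-dec (28 ℕ.≤? steps (p , q , s , t)))
               one-to-four) one-to-four) one-to-four) one-to-four} _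

  -- This makes the truncated subtraction in `excess` exact.
  steps-shapes : All (λ s → 24 ℕ.≤ steps s) shapes
  steps-shapes = toWitness {a? = all? (λ s → 24 ℕ.≤? steps s) shapes} _

  -- A total weight of at most 22 would place all sums in an interval of at most 4k - 13 integers.
  combine : All (λ s → All (λ t →
              4 ℕ.≤ excess s ℕ.+ excess t ⊎ weight s ℕ.+ weight t ℕ.≤ 22 ⊎ (s , t) ∈ shapePairs) shapes) shapes
  combine = toWitness {a? = all? (λ s → all? (λ t → 4 ℕ.≤? excess s ℕ.+ excess t ⊎-dec
    (weight s ℕ.+ weight t ℕ.≤? 22 ⊎-dec member? (≡-dec _≟ˢ_ _≟ˢ_) (s , t) shapePairs)) shapes) shapes} _

valid? : ∀ k → Decidable (Valid k)
valid? k (quad i j l m) = map′ (λ (p , q , r , s) → valid p q r s) (λ (valid p q r s) → p , q , r , s)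
  (i ℕ.<? j ×-dec j ℕ.<? l ×-dec l ℕ.<? m ×-dec m ℕ.<? k)

opaque
  unfolding windowQuads

  quads-valid : All (Valid 10) (windowQuads)
  quads-valid = toWitness {a? = all? (valid? 10) (windowQuads)} _

_≟ᵠ_ : DecidableEquality Quad
quad i j l m ≟ᵠ quad i′ j′ l′ m′ =
  map′ (λ { (refl , refl , refl , refl) → refl }) (λ { refl → refl , refl , refl , refl })
    (i ℕ.≟ i′ ×-dec j ℕ.≟ j′ ×-dec l ℕ.≟ l′ ×-dec m ℕ.≟ m′)

opaque
  unfolding windowQuads

  bottom∈quads : bottom ∈ windowQuads
  bottom∈quads = here refl

  top∈quads : top 6 ∈ windowQuads
  top∈quads = toWitness {a? = any? (top 6 ≟ᵠ_) (windowQuads)} _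

-- The chain through all sums of the first ten elements.

-- The chain ends at the last hit so far, which may lie below `lo + n`; the bound on `s` is what is
-- needed to append the next hit.
collect : ∀ {P : ℤ → Set} {Q : ℕ → Set} (Q? : Decidable Q)
          (f : ℕ → ℤ) → (∀ {s t} → s ℕ.< t → f s < f t) →
          (∀ {t} → Q t → P (f t)) → ∀ {lo} → Q lo → ∀ n →
          ∃[ s ] (s ℕ.≤ lo ℕ.+ n × Path P (count Q? lo n) (f lo) (f s))
collect Q? f f-mono g {lo} q zero = lo , ℕ.m≤m+n lo 0 , stop (g q)
collect {P} Q? f f-mono g {lo} q (suc n) with Q? (lo ℕ.+ suc n) | collect {P} Q? f f-mono g q n
... | no _   | s , s≤ , p = s , ℕ.≤-trans s≤ (ℕ.+-monoʳ-≤ lo (ℕ.n≤1+n n)) , p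
... | yes q′ | s , s≤ , p =
  lo ℕ.+ suc n , ℕ.≤-refl , subst (λ m → Path P m (f lo) (f (lo ℕ.+ suc n))) (ℕ.+-comm _ 1)
    (p ++ᴾ step (end p) (f-mono (ℕ.≤-<-trans s≤ (ℕ.+-monoʳ-< lo ℕ.≤-refl))) (stop (g q′)))

collect′ : ∀ {P : ℤ → Set} {Q : ℕ → Set} (Q? : Decidable Q)
           (f : ℕ → ℤ) → (∀ {s t} → s ℕ.< t → f s < f t) →
           (∀ {t} → Q t → P (f t)) → ∀ {lo} n → Q lo → Q (lo ℕ.+ suc n) →
           Path P (suc (count Q? lo n)) (f lo) (f (lo ℕ.+ suc n))
collect′ {P} Q? f f-mono g {lo} n q q′ with collect {P} Q? f f-mono g q n
... | s , s≤ , p = subst (λ m → Path P m (f lo) (f (lo ℕ.+ suc n))) (ℕ.+-comm _ 1)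
  (p ++ᴾ step (end p) (f-mono (ℕ.≤-<-trans s≤ (ℕ.+-monoʳ-< lo ℕ.≤-refl))) (stop (g q′)))

width-eq : ∀ s → sumℕ (coord s) bottom ℕ.+ suc (width s) ≡ sumℕ (coord s) (top 6)
width-eq (p , q , t , u) = eq p q t u
  where
  eq : ∀ p q t u →
       0 ℕ.+ p ℕ.+ (p ℕ.+ q) ℕ.+ (p ℕ.+ q ℕ.+ t) ℕ.+ suc (p ℕ.+ 2 ℕ.* q ℕ.+ 3 ℕ.* t ℕ.+ 4 ℕ.* u ℕ.+ 13)
       ≡ p ℕ.+ q ℕ.+ t ℕ.+ u ℕ.+ 2 ℕ.+ (p ℕ.+ q ℕ.+ t ℕ.+ u ℕ.+ 3) ℕ.+ (p ℕ.+ q ℕ.+ t ℕ.+ u ℕ.+ 4) ℕ.+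
         (p ℕ.+ q ℕ.+ t ℕ.+ u ℕ.+ 5)
  eq = ℕ-Ring.solve-∀

module Window (r : ℕ) (12≤r : 12 ℕ.≤ r) (a : ℕ → ℤ) (mono : Mono (4 ℕ.+ r) a)
              (small′ : ∀ {e} → Gain (4 ℕ.+ r) a e bottom (top r) → e ℕ.≤ 3) where

  open Ends r 12≤r a mono small′

  d-positive : 0ℤ < d
  d-positive = Δ-positive (ℕ.≤-trans (from-yes (6 ℕ.≤? 12)) (ℕ.≤-trans 12≤r (ℕ.m≤n+m r 4)))

  -- The last inner gap is gap `r - 2`, so the progression with difference `d` reaches up to index
  -- `r - 1`.
  Fits : Shape → Set
  Fits s = ∀ {i} → i ℕ.< r → a i ≡ a 0 + + coord s i * d

  module _ {p q s t : ℕ} (g₀ : Δ 0 ≡ + p * d) (g₁ : Δ 1 ≡ + q * d) (g₂ : Δ 2 ≡ + s * d) (g₃ : Δ 3 ≡ + t * d) where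

    next : ∀ i {m n} → a i ≡ a 0 + + n * d → Δ i ≡ + m * d → a (suc i) ≡ a 0 + + (n ℕ.+ m) * d
    next i {m} {n} e g = begin
      a (suc i)                    ≡⟨ suc-gap i ⟩
      a i + Δ i                    ≡⟨ cong₂ _+_ e g ⟩
      a 0 + + n * d + + m * d      ≡⟨ eq (a 0) (+ n) (+ m) d ⟩
      a 0 + + (n ℕ.+ m) * d        ∎
      where
      open ≡-Reasoning
      eq : ∀ x n m d → x + n * d + m * d ≡ x + (n + m) * d
      eq = ℤ-Ring.solve-∀

    a₀ : a 0 ≡ a 0 + + 0 * d
    a₀ = eq (a 0) d
      where
      eq : ∀ x d → x ≡ x + + 0 * d
      eq = ℤ-Ring.solve-∀
    a₁ = next 0 {p} {0} a₀ g₀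
    a₂ = next 1 {q} {p} a₁ g₁
    a₃ = next 2 {s} {p ℕ.+ q} a₂ g₂
    a₄ = next 3 {t} {p ℕ.+ q ℕ.+ s} a₃ g₃
    fits : Fits (p , q , s , t)
    fits {0} _ = a₀
    fits {1} _ = a₁
    fits {2} _ = a₂
    fits {3} _ = a₃
    fits {4} _ = subst (λ n → a 4 ≡ a 0 + + n * d) (sym (ℕ.+-identityʳ (p ℕ.+ q ℕ.+ s ℕ.+ t))) a₄
    fits {suc i@(suc (suc (suc (suc n))))} i<r =
      subst (λ m → a (suc i) ≡ a 0 + + m * d) (eq p q s t n)
        (next i {1} {p ℕ.+ q ℕ.+ s ℕ.+ t ℕ.+ n} (fits (ℕ.<⇒≤ i<r)) 
          (trans (inner-const (ℕ.m≤m+n 4 n , i<r) inner₄) (sym (ℤ.*-identityˡ d))))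
      where
      eq : ∀ p q s t n → p ℕ.+ q ℕ.+ s ℕ.+ t ℕ.+ n ℕ.+ 1 ≡ p ℕ.+ q ℕ.+ s ℕ.+ t ℕ.+ suc n
      eq = ℕ-Ring.solve-∀

  module _ {s : Shape} (fit : Fits s) where

    value : ℕ → ℤ
    value t = a 0 + a 0 + a 0 + a 0 + + t * d

    value-mono : ∀ {t u} → t ℕ.< u → value t < value u
    value-mono {t} {u} t<u = ℤ.+-monoʳ-< (a 0 + a 0 + a 0 + a 0) (ℤ.*-monoʳ-<-pos d {{ℤ.positive d-positive}} (ℤ.+<+ t<u))

    sum-value : ∀ {u} → Valid 10 u → sum a u ≡ value (sumℕ (coord s) u)
    sum-value {quad i j l m} (valid i<j j<l l<m m<10) = begin
      a i + a j + a l + a m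
        ≡⟨ cong₂ _+_ (cong₂ _+_ (cong₂ _+_ (fit i<r) (fit j<r)) (fit l<r)) (fit m<r) ⟩
      a 0 + + c i * d + (a 0 + + c j * d) + (a 0 + + c l * d) + (a 0 + + c m * d)
        ≡⟨ eq (a 0) d (+ c i) (+ c j) (+ c l) (+ c m) ⟩
      value (sumℕ c (quad i j l m)) ∎
      where
      open ≡-Reasoning
      c = coord s
      m<r = ℕ.≤-trans m<10 (ℕ.≤-trans (from-yes (10 ℕ.≤? 12)) 12≤r)
      l<r = ℕ.<-trans l<m m<r
      j<r = ℕ.<-trans j<l l<r
      i<r = ℕ.<-trans i<j j<r
      eq : ∀ x d i j l m → x + i * d + (x + j * d) + (x + l * d) + (x + m * d) ≡ x + x + x + x + (i + j + l + m) * d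
      eq = ℤ-Ring.solve-∀

    widen : ∀ {u} → Valid 10 u → Valid k u
    widen (valid i<j j<l l<m m<10) = valid i<j j<l l<m
      (ℕ.≤-trans m<10 (ℕ.≤-trans (from-yes (10 ℕ.≤? 12)) (ℕ.≤-trans 12≤r (ℕ.m≤n+m r 4))))

    realise : ∀ {t} → IsSum (windowSums s) t → Sum4 k a (value t)
    realise t∈ with ∈-map⁻ (sumℕ (coord s)) {xs = windowQuads} t∈
    ... | u , u∈ , refl = u , widen vu , sym (sum-value vu)
      where vu = All.lookup quads-valid u∈

    valid-top₆ : Valid 10 (top 6)
    valid-top₆ = All.lookup quads-valid top∈quads

    -- On quadruples of the window, `sum a` is an increasing function of the sum of coordinates, so
    -- the computed list of sums becomes a chain of actual sums.
    window-gain : 24 ℕ.≤ steps s → Gain k a (excess s) bottom (top 6)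
    window-gain 24≤ = gain path (trans (cong (ℕ._+ 6) (sym (ℕ.m∸n+n≡m 24≤))) (eq (excess s)))
      where
      sums = windowSums s
      path : Path (Sum4 k a) (steps s) (sum a bottom) (sum a (top 6))
      path = subst₂ (Path (Sum4 k a) (steps s))
        (sym (sum-value (All.lookup quads-valid bottom∈quads)))
        (trans (cong value (width-eq s)) (sym (sum-value valid-top₆)))
        (collect′ {Sum4 k a} (isSum? sums) value value-mono realise (width s) (∈-map⁺ (sumℕ (coord s)) bottom∈quads)
          (subst (IsSum sums) (sym (width-eq s)) (∈-map⁺ (sumℕ (coord s)) top∈quads)))
      eq : ∀ e → e ℕ.+ 24 ℕ.+ 6 ≡ 30 ℕ.+ e
      eq = ℕ-Ring.solve-∀

  record LeftEnd : Set where
    constructor leftEnd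
    field
      shape  : Shape
      shape∈ : shape ∈ shapes
      fit    : Fits shape
      gained : Gain k a (excess shape) bottom (top 6)

  classified : ∀ {s} → Fits s → s ∈ shapes ⊎ 28 ℕ.≤ steps s → LeftEnd
  classified {s} fit (inj₁ s∈) = leftEnd s s∈ fit (window-gain {s} fit (All.lookup steps-shapes s∈))
  classified {s} fit (inj₂ 28≤) = ⊥-elim (ℕ.<-irrefl refl (ℕ.≤-trans (ℕ.∸-monoˡ-≤ 24 28≤)
    (small valid-bottom (widen {s} fit (valid-top₆ {s} fit))
      (window-gain {s} fit (ℕ.≤-trans (from-yes (24 ℕ.≤? 28)) 28≤)))))

  opaque
    left-end : LeftEnd
    left-end with EndGap.end-gap {0} (from-yes (0 ℕ.<? 4)) | EndGap.end-gap {1} (from-yes (1 ℕ.<? 4))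
                | EndGap.end-gap {2} (from-yes (2 ℕ.<? 4)) | EndGap.end-gap {3} (from-yes (3 ℕ.<? 4))
    ... | p , p∈ , g₀ | q , q∈ , g₁ | s , s∈ , g₂ | t , t∈ , g₃ =
      classified (fits {p} {q} {s} {t} g₀ g₁ g₂ g₃)
        (All.lookup (All.lookup (All.lookup (All.lookup classify p∈) q∈) s∈) t∈)

-- Reflection, which exchanges the two ends.

reflect : ℕ → (ℕ → ℤ) → ℕ → ℤ
reflect r a i = - a (3 ℕ.+ r ∸ i)

reflectᵠ : ℕ → Quad → Quad
reflectᵠ r (quad i j l m) = quad (3 ℕ.+ r ∸ m) (3 ℕ.+ r ∸ l) (3 ℕ.+ r ∸ j) (3 ℕ.+ r ∸ i)

reflectᵠ-valid : ∀ {r u} → Valid (4 ℕ.+ r) u → Valid (4 ℕ.+ r) (reflectᵠ r u)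
reflectᵠ-valid {r} {quad i j l m} (valid i<j j<l l<m (s≤s m≤)) =
  valid (ℕ.∸-monoʳ-< l<m m≤) (ℕ.∸-monoʳ-< j<l l≤) (ℕ.∸-monoʳ-< i<j j≤) (s≤s (ℕ.m∸n≤m (3 ℕ.+ r) i))
  where
  l≤ = ℕ.≤-trans (ℕ.<⇒≤ l<m) m≤
  j≤ = ℕ.≤-trans (ℕ.<⇒≤ j<l) l≤

rank-reflectᵠ : ∀ {r u} → Valid (4 ℕ.+ r) u → rank (reflectᵠ r u) ℕ.+ rank u ≡ 4 ℕ.* (3 ℕ.+ r)
rank-reflectᵠ {r} {quad i j l m} (valid i<j j<l l<m (s≤s m≤)) = begin
  (K ∸ m) ℕ.+ (K ∸ l) ℕ.+ (K ∸ j) ℕ.+ (K ∸ i) ℕ.+ (i ℕ.+ j ℕ.+ l ℕ.+ m)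
    ≡⟨ eq (K ∸ m) (K ∸ l) (K ∸ j) (K ∸ i) i j l m ⟩
  (K ∸ m ℕ.+ m) ℕ.+ ((K ∸ l ℕ.+ l) ℕ.+ ((K ∸ j ℕ.+ j) ℕ.+ ((K ∸ i ℕ.+ i) ℕ.+ 0)))
    ≡⟨ cong₂ ℕ._+_ (ℕ.m∸n+n≡m m≤) (cong₂ ℕ._+_ (ℕ.m∸n+n≡m l≤)
         (cong₂ ℕ._+_ (ℕ.m∸n+n≡m j≤) (cong (ℕ._+ 0) (ℕ.m∸n+n≡m i≤)))) ⟩
  4 ℕ.* K ∎
  where
  open ≡-Reasoning
  K = 3 ℕ.+ r
  l≤ = ℕ.≤-trans (ℕ.<⇒≤ l<m) m≤
  j≤ = ℕ.≤-trans (ℕ.<⇒≤ j<l) l≤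
  i≤ = ℕ.≤-trans (ℕ.<⇒≤ i<j) j≤
  eq : ∀ x y z w i j l m → x ℕ.+ y ℕ.+ z ℕ.+ w ℕ.+ (i ℕ.+ j ℕ.+ l ℕ.+ m) ≡
       (x ℕ.+ m) ℕ.+ ((y ℕ.+ l) ℕ.+ ((z ℕ.+ j) ℕ.+ ((w ℕ.+ i) ℕ.+ 0)))
  eq = ℕ-Ring.solve-∀

reflectᵠ-top : ∀ r → reflectᵠ r (top r) ≡ bottom
reflectᵠ-top r rewrite ℕ.n∸n≡0 r | ℕ.m+n∸n≡m 1 r | ℕ.m+n∸n≡m 2 r | ℕ.m+n∸n≡m 3 r = refl

module _ {r : ℕ} {a : ℕ → ℤ} where

  sum-reflect : ∀ u → - sum (reflect r a) u ≡ sum a (reflectᵠ r u)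
  sum-reflect (quad i j l m) = eq (a (3 ℕ.+ r ∸ i)) (a (3 ℕ.+ r ∸ j)) (a (3 ℕ.+ r ∸ l)) (a (3 ℕ.+ r ∸ m))
    where
    eq : ∀ x y z w → - (- x + - y + - z + - w) ≡ w + z + y + x
    eq = ℤ-Ring.solve-∀

  reflect-mono : Mono (4 ℕ.+ r) a → Mono (4 ℕ.+ r) (reflect r a)
  reflect-mono mono {i} (s≤s i<) =
    ℤ.neg-mono-< (subst (λ n → a (3 ℕ.+ r ∸ suc i) < a n) (sym (ℕ.+-∸-assoc 1 i<)) (mono lt))
    where
    lt : suc (3 ℕ.+ r ∸ suc i) ℕ.< 4 ℕ.+ r
    lt = s≤s (ℕ.≤-trans (ℕ.≤-reflexive (sym (ℕ.+-∸-assoc 1 i<))) (ℕ.m∸n≤m (3 ℕ.+ r) i))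

  -- A quadruple and its reflection have ranks adding up to `4 * (3 + r)`, so the reversed chain
  -- spans the same rank difference. Adding `rank u + rank v` to both sides avoids subtraction.
  reflect-gain : ∀ {e u v} → Valid (4 ℕ.+ r) u → Valid (4 ℕ.+ r) v →
                 Gain (4 ℕ.+ r) (reflect r a) e u v → Gain (4 ℕ.+ r) a e (reflectᵠ r v) (reflectᵠ r u)
  reflect-gain {e} {u} {v} vu vv (gain {n} p x) = gain
    (subst₂ (Path _ n) (sum-reflect v) (sum-reflect u)
      (map⁻ (λ { (w , vw , refl) → reflectᵠ r w , reflectᵠ-valid vw , sum-reflect w }) p))
    (ℕ.+-cancelʳ-≡ (rank u ℕ.+ rank v) _ _ (begin
      n ℕ.+ rank v′ ℕ.+ (rank u ℕ.+ rank v)  ≡⟨ eq₁ n (rank v′) (rank u) (rank v) ⟩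
      n ℕ.+ rank u ℕ.+ (rank v′ ℕ.+ rank v)  ≡⟨ cong₂ ℕ._+_ x (trans (rank-reflectᵠ vv) (sym (rank-reflectᵠ vu))) ⟩
      rank v ℕ.+ e ℕ.+ (rank u′ ℕ.+ rank u)  ≡⟨ eq₂ (rank v) e (rank u′) (rank u) ⟩
      rank u′ ℕ.+ e ℕ.+ (rank u ℕ.+ rank v)  ∎))
    where
    open ≡-Reasoning
    u′ = reflectᵠ r u
    v′ = reflectᵠ r v
    eq₁ : ∀ n w u v → n ℕ.+ w ℕ.+ (u ℕ.+ v) ≡ n ℕ.+ u ℕ.+ (w ℕ.+ v)
    eq₁ = ℕ-Ring.solve-∀
    eq₂ : ∀ v e w u → v ℕ.+ e ℕ.+ (w ℕ.+ u) ≡ w ℕ.+ e ℕ.+ (u ℕ.+ v)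
    eq₂ = ℕ-Ring.solve-∀

  reflect-small : (∀ {e} → Gain (4 ℕ.+ r) a e bottom (top r) → e ℕ.≤ 3) →
                  ∀ {e} → Gain (4 ℕ.+ r) (reflect r a) e bottom (top r) → e ℕ.≤ 3
  reflect-small small {e} g =
    small (subst (λ u → Gain (4 ℕ.+ r) a e u (top r)) (reflectᵠ-top r) (reflect-gain valid-bottom valid-top g))

-- Both ends together.

module BothEnds (j : ℕ) (a : ℕ → ℤ) (mono : Mono (16 ℕ.+ j) a)
                (small : ∀ {e} → Gain (16 ℕ.+ j) a e bottom (top (12 ℕ.+ j)) → e ℕ.≤ 3) where

  r : ℕ
  r = 12 ℕ.+ j

  12≤r : 12 ℕ.≤ r
  12≤r = ℕ.m≤m+n 12 j

  a′ : ℕ → ℤ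
  a′ = reflect r a

  mono′ : Mono (16 ℕ.+ j) a′
  mono′ = reflect-mono {r} {a} mono

  small′ : ∀ {e} → Gain (16 ℕ.+ j) a′ e bottom (top r) → e ℕ.≤ 3
  small′ = reflect-small {r} {a} small

  module E = Ends r 12≤r a mono small
  module E′ = Ends r 12≤r a′ mono′ small′
  module W = Window r 12≤r a mono small
  module W′ = Window r 12≤r a′ mono′ small′
  module L = W.LeftEnd W.left-end
  module L′ = W′.LeftEnd W′.left-end

  -- Gap 4 of the reflected sequence is gap `10 + j` of the original one, the last inner gap.
  d′≡d : E′.d ≡ E.d
  d′≡d = trans (eq (a (10 ℕ.+ j)) (a (11 ℕ.+ j)))
    (E.inner-const {10 ℕ.+ j} {4} (ℕ.m≤m+n 4 _ , ℕ.≤-refl) (ℕ.≤-refl , ℕ.m≤m+n 6 _))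
    where
    eq : ∀ x y → - x - (- y) ≡ y - x
    eq = ℤ-Ring.solve-∀

  valid-top₆ : Valid (16 ℕ.+ j) (top 6)
  valid-top₆ = valid (from-yes (6 ℕ.<? 7)) (from-yes (7 ℕ.<? 8)) (from-yes (8 ℕ.<? 9)) (ℕ.m≤m+n 10 _)

  -- The left window chain ends at (6, 7, 8, 9) and the reflected right one begins at (6 + j, 7 + j,
  -- 8 + j, 9 + j), so a climb joins them and the excesses add up. For k = 16 the two quadruples
  -- coincide.
  excess-sum : excess L.shape ℕ.+ excess L′.shape ℕ.≤ 3
  excess-sum = small (subst (λ e → Gain (16 ℕ.+ j) a (e ℕ.+ excess L′.shape) bottom (top r)) (ℕ.+-identityʳ _)
    ((L.gained ⊕ climb mono valid-top₆ (reflectᵠ-valid {r} valid-top₆)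
        (le (ℕ.m≤m+n 6 _) (ℕ.m≤m+n 7 _) (ℕ.m≤m+n 8 _) (ℕ.m≤m+n 9 _)))
      ⊕ reflect-gain {r} {a} valid-bottom valid-top₆ L′.gained))

  -- The two descriptions agree on a (11 + j), the last element of the inner progression.
  largest : a (15 ℕ.+ j) ≡ a 0 + + (coord L.shape (11 ℕ.+ j) ℕ.+ coord L′.shape 4) * E.d
  largest = begin
    a (15 ℕ.+ j)
      ≡⟨ eq₁ (a (15 ℕ.+ j)) (+ c′ * E.d) ⟩
    - (- a (15 ℕ.+ j) + + c′ * E.d) + + c′ * E.d
      ≡⟨ cong (λ z → - (- a (15 ℕ.+ j) + + c′ * z) + + c′ * E.d) d′≡d ⟨
    - (a′ 0 + + c′ * E′.d) + + c′ * E.d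
      ≡⟨ cong (λ z → - z + + c′ * E.d) (L′.fit (ℕ.m≤m+n 5 _)) ⟨
    - - a (11 ℕ.+ j) + + c′ * E.d
      ≡⟨ cong (λ z → - - z + + c′ * E.d) (L.fit ℕ.≤-refl) ⟩
    - - (a 0 + + c * E.d) + + c′ * E.d
      ≡⟨ eq₂ (a 0) (+ c) (+ c′) E.d ⟩
    a 0 + + (c ℕ.+ c′) * E.d ∎
    where
    open ≡-Reasoning
    c = coord L.shape (11 ℕ.+ j)
    c′ = coord L′.shape 4
    eq₁ : ∀ x y → x ≡ - (- x + y) + y
    eq₁ = ℤ-Ring.solve-∀
    eq₂ : ∀ x c c′ d → - - (x + c * d) + c′ * d ≡ x + (c + c′) * d
    eq₂ = ℤ-Ring.solve-∀

-- From sets as lists to increasing sequences, and counting of sums.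

unique-⊆-length : ∀ {A : Set} {xs ys : List A} → Unique xs → (∀ {x} → x ∈ xs → x ∈ ys) → length xs ℕ.≤ length ys
unique-⊆-length [] _ = z≤n
unique-⊆-length {xs = x ∷ xs} (x∉ ∷ u) xs⊆ with ∈-∃++ (xs⊆ (here refl))
... | ys , zs , refl = ℕ.≤-trans (s≤s (unique-⊆-length u sub)) (ℕ.≤-reflexive (sym (length-++-sucʳ ys x zs)))
  where
  sub : ∀ {y} → y ∈ xs → y ∈ ys ++ zs
  sub y∈ with ∈-++⁻ ys (xs⊆ (there y∈))
  ... | inj₁ y∈ys         = ∈-++⁺ˡ y∈ys
  ... | inj₂ (here refl)  = ⊥-elim (All.lookup x∉ y∈ refl)
  ... | inj₂ (there y∈zs) = ∈-++⁺ʳ ys y∈zs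

sort-unique : ∀ {A} → Unique A → AllPairs _<_ (sort A)
sort-unique {A} u = AllPairs.zipWith (λ (x≤y , x≢y) → ℤ.≤∧≢⇒< x≤y x≢y)
  (Sorted⇒AllPairs ℤ.≤-totalOrder (sort-↗ A) , ↭ₛ.Unique-resp-↭ (setoid ℤ) (↭⇒↭ₛ (↭-sym (sort-↭ A))) u)

nth : List ℤ → ℕ → ℤ
nth []       _       = 0ℤ
nth (x ∷ xs) zero    = x
nth (x ∷ xs) (suc n) = nth xs n

nth∈ : ∀ xs {i} → i ℕ.< length xs → nth xs i ∈ xs
nth∈ (x ∷ xs) {zero}  _         = here refl
nth∈ (x ∷ xs) {suc i} (s≤s i<) = there (nth∈ xs i<)

∈nth : ∀ {xs x} → x ∈ xs → ∃[ i ] (i ℕ.< length xs × x ≡ nth xs i)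
∈nth (here refl) = 0 , s≤s z≤n , refl
∈nth (there x∈) with ∈nth x∈
... | i , i< , e = suc i , s≤s i< , e

nth-mono : ∀ {xs} → AllPairs _<_ xs → Mono (length xs) (nth xs)
nth-mono {x ∷ y ∷ xs} ((x<y ∷ _) ∷ _) {zero}  _        = x<y
nth-mono {x ∷ xs}     (_ ∷ ps)        {suc i} (s≤s i<) = nth-mono ps i<

module _ {k : ℕ} {a : ℕ → ℤ} (mono : Mono k a) where

  mono-< : ∀ {i j} → i ℕ.< j → j ℕ.< k → a i < a j
  mono-< i<j = go (ℕ.≤⇒≤′ i<j)
    where
    go : ∀ {i j} → suc i ℕ.≤′ j → j ℕ.< k → a i < a j
    go ℕ.≤′-refl       j<k = mono j<k
    go (ℕ.≤′-step i<j) j<k = ℤ.<-trans (go i<j (ℕ.<⇒≤ j<k)) (mono j<k)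

  mono-≤ : ∀ {i j} → i ℕ.≤ j → j ℕ.< k → a i ≤ a j
  mono-≤ {i} {j} i≤j j<k with ℕ.m≤n⇒m<n∨m≡n i≤j
  ... | inj₁ i<j  = ℤ.<⇒≤ (mono-< i<j j<k)
  ... | inj₂ refl = ℤ.≤-refl

  mono-cancel-< : ∀ {i j} → i ℕ.< k → a i < a j → i ℕ.< j
  mono-cancel-< {i} {j} i<k ai<aj with i ℕ.<? j
  ... | yes i<j = i<j
  ... | no i≮j  = ⊥-elim (ℤ.<-irrefl refl (ℤ.<-≤-trans ai<aj (mono-≤ (ℕ.≮⇒≥ i≮j) i<k)))

path-≤ : ∀ {P n s t} → Path P n s t → s ≤ t
path-≤ (stop _)       = ℤ.≤-refl
path-≤ (step _ s<t p) = ℤ.≤-trans (ℤ.<⇒≤ s<t) (path-≤ p)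

-- The lower bound carries the induction: a new first value is smaller than all later ones, hence
-- different from them.
path-values : ∀ {P n s t} → Path P n s t → ∃[ L ] (length L ≡ suc n × All (s ≤_) L × Unique L × All P L)
path-values {s = s} (stop ps) = s ∷ [] , refl , ℤ.≤-refl ∷ [] , [] ∷ [] , ps ∷ []
path-values {s = s} (step ps s<t p) with path-values p
... | L , len , ≤L , uL , pL =
  s ∷ L , cong suc len , ℤ.≤-refl ∷ All.map (λ t≤ → ℤ.≤-trans (ℤ.<⇒≤ s<t) t≤) ≤L ,
  All.map (λ t≤ → ℤ.<⇒≢ (ℤ.<-≤-trans s<t t≤)) ≤L ∷ uL , ps ∷ pL

sumL : List ℤ → ℤ
sumL = foldr _+_ 0ℤ

sumL-↭ : ∀ {xs ys} → xs ↭ ys → sumL xs ≡ sumL ys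
sumL-↭ p = ↭ₛ.foldr-commMonoid (setoid ℤ) ℤ.+-0-isCommutativeMonoid (↭⇒↭ₛ p)

∣gcdL : ∀ {d} A → (∀ {x} → x ∈ A → d ℤᵘ.∣ x) → d ℤᵘ.∣ gcdL A
∣gcdL [] _ = _ ∣0
∣gcdL {d} (x ∷ A) h = gcd-greatest {x} {gcdL A} {d} (h (here refl)) (∣gcdL {d} A (λ y∈ → h (there y∈)))

module Sorted {A : List ℤ} {k} (len : length A ≡ k) (u : Unique A) where

  B : List ℤ
  B = sort A

  a : ℕ → ℤ
  a = nth B

  lenB : length B ≡ k
  lenB = trans (↭-length (sort-↭ A)) len

  mono : Mono k a
  mono = subst (λ k → Mono k a) lenB (nth-mono (sort-unique u))

  a∈ : ∀ {i} → i ℕ.< k → a i ∈ A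
  a∈ i<k = ∈-resp-↭ (sort-↭ A) (nth∈ B (subst (_ ℕ.<_) (sym lenB) i<k))

  ∈a : ∀ {x} → x ∈ A → ∃[ i ] (i ℕ.< k × x ≡ a i)
  ∈a x∈ with ∈nth (∈-resp-↭ (↭-sym (sort-↭ A)) x∈)
  ... | i , i< , e = i , subst (i ℕ.<_) lenB i< , e

  sum4⇒In4 : ∀ {s} → Sum4 k a s → In4Sumset A s
  sum4⇒In4 (quad i j l m , valid i<j j<l l<m m<k , e) =
    a i , a j , a l , a m , a∈ i<k , a∈ j<k , a∈ l<k , a∈ m<k ,
    ℤ.<⇒≢ (lt i<j j<k) , ℤ.<⇒≢ (lt (ℕ.<-trans i<j j<l) l<k) ,
    ℤ.<⇒≢ (lt (ℕ.<-trans i<j (ℕ.<-trans j<l l<m)) m<k) ,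
    ℤ.<⇒≢ (lt j<l l<k) , ℤ.<⇒≢ (lt (ℕ.<-trans j<l l<m) m<k) , ℤ.<⇒≢ (lt l<m m<k) , e
    where
    lt = mono-< mono
    l<k = ℕ.<-trans l<m m<k
    j<k = ℕ.<-trans j<l l<k
    i<k = ℕ.<-trans i<j j<k

  -- Sorting the four summands makes their indices increase and does not change the sum.
  In4⇒sum4 : ∀ {s} → In4Sumset A s → Sum4 k a s
  In4⇒sum4 {s} (x , y , z , w , x∈ , y∈ , z∈ , w∈ , x≢y , x≢z , x≢w , y≢z , y≢w , z≢w , e) =
    go (sort l₄) (sort-↭ l₄) (sort-unique uniq)
    where
    l₄ = x ∷ y ∷ z ∷ w ∷ []
    uniq : Unique l₄
    uniq = (x≢y ∷ x≢z ∷ x≢w ∷ []) ∷ (y≢z ∷ y≢w ∷ []) ∷ (z≢w ∷ []) ∷ [] ∷ []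
    l₄⊆A : All (_∈ A) l₄
    l₄⊆A = x∈ ∷ y∈ ∷ z∈ ∷ w∈ ∷ []
    go : ∀ L → L ↭ l₄ → AllPairs _<_ L → Sum4 k a s
    go L p ps with ↭-length p
    go (p ∷ q ∷ r ∷ t ∷ []) σ ((p<q ∷ _) ∷ (q<r ∷ _) ∷ (r<t ∷ _) ∷ _) | refl
      with ∈a (All.lookup l₄⊆A (∈-resp-↭ σ (here refl)))
         | ∈a (All.lookup l₄⊆A (∈-resp-↭ σ (there (here refl))))
         | ∈a (All.lookup l₄⊆A (∈-resp-↭ σ (there (there (here refl)))))
         | ∈a (All.lookup l₄⊆A (∈-resp-↭ σ (there (there (there (here refl))))))
    ... | i , i<k , refl | j , j<k , refl | l , l<k , refl | m , m<k , refl =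
      quad i j l m , valid (mono-cancel-< mono i<k p<q) (mono-cancel-< mono j<k q<r) (mono-cancel-< mono l<k r<t) m<k ,
      trans e (trans (eq₁ x y z w) (trans (sym (sumL-↭ σ)) (eq₂ (a i) (a j) (a l) (a m))))
      where
      eq₁ : ∀ x y z w → x + y + z + w ≡ x + (y + (z + (w + 0ℤ)))
      eq₁ = ℤ-Ring.solve-∀
      eq₂ : ∀ x y z w → x + (y + (z + (w + 0ℤ))) ≡ x + y + z + w
      eq₂ = ℤ-Ring.solve-∀

  module _ {n} (card : Card4Sumset A n) where

    private
      S = proj₁ card
      uS = proj₁ (proj₂ card)
      S⇔ = proj₁ (proj₂ (proj₂ card))
      lenS = proj₂ (proj₂ (proj₂ card))

    path-length : ∀ {m s t} → Path (Sum4 k a) m s t → suc m ℕ.≤ n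
    path-length p with path-values p
    ... | L , lenL , _ , uL , pL = subst₂ ℕ._≤_ lenL lenS
      (unique-⊆-length uL (λ s∈ → Equivalence.from (S⇔ _) (sum4⇒In4 (All.lookup pL s∈))))

    interval-length : ∀ {lo w} → (∀ {s} → Sum4 k a s → lo ≤ s × s ≤ lo + + w) → n ℕ.≤ suc w
    interval-length {lo} {w} bounds = subst₂ ℕ._≤_ lenS
      (trans (length-map (λ t → lo + + t) (upTo (suc w))) (length-upTo (suc w)))
      (unique-⊆-length uS sub)
      where
      sub : ∀ {s} → s ∈ S → s ∈ map (λ t → lo + + t) (upTo (suc w))
      sub {s} s∈ with bounds (In4⇒sum4 (Equivalence.to (S⇔ s) s∈))
      ... | lo≤s , s≤ = subst (_∈ _) eq (∈-map⁺ (λ t → lo + + t) (∈-upTo⁺ (s≤s t≤w)))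
        where
        t = ℤ.∣ s - lo ∣
        +t : + t ≡ s - lo
        +t = ℤ.0≤i⇒+∣i∣≡i (ℤ.i≤j⇒0≤j-i lo≤s)
        eq′ : ∀ x y → y + (x - y) ≡ x
        eq′ = ℤ-Ring.solve-∀
        eq : lo + + t ≡ s
        eq = trans (cong (λ z → lo + z) +t) (eq′ s lo)
        eq″ : ∀ y w → y + w - y ≡ w
        eq″ = ℤ-Ring.solve-∀
        t≤w : t ℕ.≤ w
        t≤w = ℤ.drop‿+≤+ (subst₂ _≤_ (sym +t) (eq″ lo (+ w)) (ℤ.+-monoˡ-≤ (- lo) s≤))

-- Holes at the ends, and the complement in [0, k + 2].

firsts : Shape → List ℕ
firsts (p , q , s , _) = 0 ∷ p ∷ p ℕ.+ q ∷ p ℕ.+ q ℕ.+ s ∷ []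

holes : Shape → List ℕ
holes s = filter (λ n → ¬? (member? ℕ._≟_ n (firsts s))) (upTo (coord s 4))

coord∈firsts : ∀ s {i} → i ℕ.< 4 → coord s i ∈ firsts s
coord∈firsts s {0} _ = here refl
coord∈firsts s {1} _ = there (here refl)
coord∈firsts s {2} _ = there (there (here refl))
coord∈firsts s {3} _ = there (there (there (here refl)))
coord∈firsts s {suc (suc (suc (suc _)))} (s≤s (s≤s (s≤s (s≤s ()))))

firsts-coord : ∀ s {n} → n ∈ firsts s → ∃[ i ] (i ℕ.< 4 × n ≡ coord s i)
firsts-coord s (here e) = 0 , from-yes (0 ℕ.<? 4) , e
firsts-coord s (there (here e)) = 1 , from-yes (1 ℕ.<? 4) , e
firsts-coord s (there (there (here e))) = 2 , from-yes (2 ℕ.<? 4) , e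
firsts-coord s (there (there (there (here e)))) = 3 , from-yes (3 ℕ.<? 4) , e

hole<end : ∀ s {h} → h ∈ holes s → h ℕ.< coord s 4
hole<end s h∈ = ∈-upTo⁻ (proj₁ (∈-filter⁻ (λ n → ¬? (member? ℕ._≟_ n (firsts s))) {xs = upTo (coord s 4)} h∈))

module _ {k r : ℕ} (4<r : 4 ℕ.< r) {a : ℕ → ℤ} (mono : Mono k a)
         (s : Shape) (fit : ∀ {i} → i ℕ.< r → a i ≡ a 0 + + coord s i) where

  -- The first four elements lie at `firsts`, which contains no hole; all others are at least `a 4`,
  -- beyond every hole.
  avoid : ∀ {i h} → i ℕ.< k → h ∈ holes s → a i ≢ a 0 + + h
  avoid {i} {h} i<k h∈ e with i ℕ.<? 4
  ... | yes i<4 = proj₂ (∈-filter⁻ (λ n → ¬? (member? ℕ._≟_ n (firsts s))) {xs = upTo (coord s 4)} h∈)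
    (subst (_∈ firsts s) (ℤ.+-injective (∙-cancelˡ (a 0) _ _ (trans (sym (fit (ℕ.<-trans i<4 4<r))) e))) (coord∈firsts s i<4))
  ... | no i≮4  = ℤ.<-irrefl (sym e) (ℤ.<-≤-trans (ℤ.+-monoʳ-< (a 0) (ℤ.+<+ (hole<end s h∈)))
    (ℤ.≤-trans (ℤ.≤-reflexive (sym (fit 4<r))) (mono-≤ mono (ℕ.≮⇒≥ i≮4) i<k)))

  attain : ∀ {n} → n ℕ.< coord s 4 → n ∉ holes s → ∃[ i ] (i ℕ.< 4 × a i ≡ a 0 + + n)
  attain {n} n< n∉ with member? ℕ._≟_ n (firsts s)
  ... | no n∉f = ⊥-elim (n∉ (∈-filter⁺ (λ n → ¬? (member? ℕ._≟_ n (firsts s))) (∈-upTo⁺ n<) n∉f))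
  ... | yes n∈ with firsts-coord s n∈
  ...   | i , i<4 , refl = i , i<4 , fit (ℕ.<-trans i<4 4<r)

-- There are 7 + j inner gaps, so with inner gap 1 the maximum is `coord s 4 + coord t 4 + 7 + j`,
-- while k + 2 = 18 + j.
slack : Shape → Shape → ℕ
slack s t = 11 ∸ (coord s 4 ℕ.+ coord t 4)

-- The complement of A in [0, k + 2] for k = 16 + j, in increasing order: slack is the distance from the maximum of A
-- to k + 2, so the right-hand holes and the numbers beyond the maximum are listed by their distances from k + 2.
removed : ℕ → Shape → Shape → List ℕ
removed j s t = holes s ++ map ((18 ℕ.+ j) ∸_) (map (slack s t ℕ.+_) (reverse (holes t)) ++ downFrom (slack s t))

module _ {j : ℕ} {s t : Shape} {m : ℕ} (m+slack : m ℕ.+ slack s t ≡ 18 ℕ.+ j) where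

  private
    δ = slack s t
    shifted = map (δ ℕ.+_) (reverse (holes t))

    from-top : ∀ h → 18 ℕ.+ j ∸ (δ ℕ.+ h) ≡ m ∸ h
    from-top h = trans (sym (ℕ.∸-+-assoc (18 ℕ.+ j) δ h)) (cong (_∸ h) (trans (cong (_∸ δ) (sym m+slack)) (ℕ.m+n∸n≡m m δ)))

  removed⁻ : ∀ {h} → h ∈ removed j s t → h ∈ holes s ⊎ m ℕ.< h ⊎ (∃[ h′ ] (h′ ∈ holes t × h ≡ m ∸ h′))
  removed⁻ h∈ with ∈-++⁻ (holes s) h∈
  ... | inj₁ h∈s = inj₁ h∈s
  ... | inj₂ h∈R with ∈-map⁻ ((18 ℕ.+ j) ∸_) {xs = shifted ++ downFrom δ} h∈R
  ...   | x , x∈ , refl with ∈-++⁻ shifted x∈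
  ...     | inj₂ x∈δ = inj₂ (inj₁ (ℕ.m+n≤o⇒m≤o∸n (suc m) (ℕ.≤-trans (ℕ.+-monoʳ-< m (∈-downFrom⁻ x∈δ)) (ℕ.≤-reflexive m+slack))))
  ...     | inj₁ x∈t with ∈-map⁻ (δ ℕ.+_) {xs = reverse (holes t)} x∈t
  ...       | h′ , h′∈ , refl = inj₂ (inj₂ (h′ , ∈-resp-↭ (↭-reverse (holes t)) h′∈ , from-top h′))

  removed⁺ : ∀ {n} → n ℕ.≤ 18 ℕ.+ j → n ∉ removed j s t → n ∉ holes s × n ℕ.≤ m × m ∸ n ∉ holes t
  removed⁺ {n} n≤ n∉ = (λ n∈ → n∉ (∈-++⁺ˡ n∈)) , n≤m , λ n∈ → upper (ℕ.m∸[m∸n]≡n n≤m) n∈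
    where
    from : ∀ {x} → x ∈ shifted ++ downFrom δ → 18 ℕ.+ j ∸ x ≢ n
    from x∈ refl = n∉ (∈-++⁺ʳ (holes s) (∈-map⁺ ((18 ℕ.+ j) ∸_) x∈))
    n≤m : n ℕ.≤ m
    n≤m = ℕ.≮⇒≥ λ m<n → from (∈-++⁺ʳ shifted (∈-downFrom⁺ (ℕ.<-≤-trans (ℕ.∸-monoʳ-< m<n n≤)
      (ℕ.≤-reflexive (trans (cong (_∸ m) (sym m+slack)) (ℕ.m+n∸m≡n m δ)))))) (ℕ.m∸[m∸n]≡n n≤)
    upper : ∀ {h} → m ∸ h ≡ n → h ∉ holes t
    upper {h} e h∈ = from (∈-++⁺ˡ (∈-map⁺ (δ ℕ.+_) (∈-resp-↭ (↭-sym (↭-reverse (holes t))) h∈))) (trans (from-top h) e)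

removed-triple : ∀ j {s t} → (s , t) ∈ shapePairs → map +_ (removed j s t) ∈ triples (16 ℕ.+ j)
removed-triple j = All.lookup {P = λ (s , t) → map +_ (removed j s t) ∈ triples (16 ℕ.+ j)} table
  where
  table : All (λ (s , t) → map +_ (removed j s t) ∈ triples (16 ℕ.+ j)) shapePairs
  -- `triples` contains `j + 1` and `j + 2`; with the numerals in front, both sides compute to the
  -- same terms for variable `j`.
  table rewrite ℕ.+-comm j 1 | ℕ.+-comm j 2 =
    here refl ∷
    there (here refl) ∷
    there (there (here refl)) ∷
    there (there (there (here refl))) ∷
    there (there (there (there (here refl)))) ∷
    there (there (there (there (there (here refl))))) ∷
    there (there (there (there (there (there (here refl)))))) ∷
    there (there (there (there (there (there (there (here refl))))))) ∷
    there (there (there (there (there (there (there (there (here refl)))))))) ∷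
    there (there (there (there (there (there (there (there (there (here refl))))))))) ∷
    there (there (there (there (there (there (there (there (there (there (here refl)))))))))) ∷
    there (there (there (there (there (there (there (there (there (there (there (here refl))))))))))) ∷ []

shapePairs-length : ∀ {s t} → (s , t) ∈ shapePairs → coord s 4 ℕ.+ coord t 4 ℕ.≤ 11
shapePairs-length = All.lookup {P = λ (s , t) → coord s 4 ℕ.+ coord t 4 ℕ.≤ 11}
  (toWitness {a? = all? (λ (s , t) → coord s 4 ℕ.+ coord t 4 ℕ.≤? 11) shapePairs} _)

compatible : ∀ {s t} → s ∈ shapes → t ∈ shapes → excess s ℕ.+ excess t ℕ.≤ 3 →
             23 ℕ.≤ weight s ℕ.+ weight t → (s , t) ∈ shapePairs
compatible {s} {t} s∈ t∈ light heavy = go (All.lookup (All.lookup combine s∈) t∈)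
  where
  go : 4 ℕ.≤ excess s ℕ.+ excess t ⊎ weight s ℕ.+ weight t ℕ.≤ 22 ⊎ (s , t) ∈ shapePairs → (s , t) ∈ shapePairs
  go (inj₁ 4≤)         = ⊥-elim (ℕ.<-irrefl refl (ℕ.≤-trans 4≤ light))
  go (inj₂ (inj₁ ≤22)) = ⊥-elim (ℕ.<-irrefl refl (ℕ.≤-trans heavy ≤22))
  go (inj₂ (inj₂ st∈)) = st∈

-- Determination of the extremal sets.

module Extremal (j : ℕ) {A : List ℤ} (uA : Unique A) (len : length A ≡ 16 ℕ.+ j)
                (min0 : MinIsZero A) (gcd1 : gcdL A ≡ 1ℤ) (card : Card4Sumset A (4 ℕ.* (16 ℕ.+ j) ∸ 12)) where

  k r : ℕ
  k = 16 ℕ.+ j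
  r = 12 ℕ.+ j

  open Sorted len uA using (a; mono; a∈; ∈a; path-length; interval-length)

  size : 4 ℕ.* (16 ℕ.+ j) ∸ 12 ≡ 52 ℕ.+ 4 ℕ.* j
  size = trans (cong (_∸ 12) (eq j)) (ℕ.m+n∸m≡n 12 _)
    where
    eq : ∀ j → 4 ℕ.* (16 ℕ.+ j) ≡ 12 ℕ.+ (52 ℕ.+ 4 ℕ.* j)
    eq = ℕ-Ring.solve-∀

  -- The rank rises by 4k - 16 from `bottom` to `top r`, so a chain of excess `e` shows 4k - 15 + e
  -- distinct sums, and there are only 4k - 12.
  small : ∀ {e} → Gain k a e bottom (top r) → e ℕ.≤ 3
  small {e} (gain {n} p x) = ℕ.+-cancelˡ-≤ (55 ℕ.+ 4 ℕ.* j) e 3 (begin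
    55 ℕ.+ 4 ℕ.* j ℕ.+ e      ≡⟨ eq₁ j e ⟩
    suc (rank (top r) ℕ.+ e)  ≡⟨ cong suc x ⟨
    suc (n ℕ.+ 6)             ≤⟨ ℕ.+-monoˡ-≤ 6 (path-length card p) ⟩
    4 ℕ.* k ∸ 12 ℕ.+ 6        ≡⟨ cong (ℕ._+ 6) size ⟩
    52 ℕ.+ 4 ℕ.* j ℕ.+ 6      ≡⟨ eq₂ j ⟩
    55 ℕ.+ 4 ℕ.* j ℕ.+ 3      ∎)
    where
    open ℕ.≤-Reasoning
    eq₁ : ∀ j e → 55 ℕ.+ 4 ℕ.* j ℕ.+ e ≡ suc (12 ℕ.+ j ℕ.+ (1 ℕ.+ (12 ℕ.+ j)) ℕ.+ (2 ℕ.+ (12 ℕ.+ j)) ℕ.+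
          (3 ℕ.+ (12 ℕ.+ j)) ℕ.+ e)
    eq₁ = ℕ-Ring.solve-∀
    eq₂ : ∀ j → 52 ℕ.+ 4 ℕ.* j ℕ.+ 6 ≡ 55 ℕ.+ 4 ℕ.* j ℕ.+ 3
    eq₂ = ℕ-Ring.solve-∀

  open BothEnds j a mono small
    using (a′; mono′; module E; module E′; module W; module W′; module L; module L′; d′≡d; excess-sum; largest)

  S U : Shape
  S = L.shape
  U = L′.shape

  d : ℤ
  d = E.d

  0<k : 0 ℕ.< k
  0<k = s≤s z≤n

  a₀ : a 0 ≡ 0ℤ
  a₀ with ∈a (proj₁ min0)
  ... | i , i<k , e = ℤ.≤-antisym (ℤ.≤-trans (mono-≤ mono z≤n i<k) (ℤ.≤-reflexive (sym e))) (proj₂ min0 _ (a∈ 0<k))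

  reflect-reflect : ∀ {i} → i ℕ.< k → 15 ℕ.+ j ∸ (15 ℕ.+ j ∸ i) ≡ i
  reflect-reflect (s≤s i≤) = ℕ.m∸[m∸n]≡n i≤

  -- The left description handles the first four elements. The right one reaches from the maximum
  -- down to index 4, and the maximum is a multiple of `d` by `largest`.
  d∣a : ∀ {i} → i ℕ.< k → d ℤˢ.∣ a i
  d∣a {i} i<k with i ℕ.<? 4
  ... | yes i<4 = low (ℕ.<-≤-trans i<4 (ℕ.m≤m+n 4 _))
    where
    low : i ℕ.< r → d ℤˢ.∣ a i
    low i<r = ℤˢ.divides (+ coord S i) (trans (L.fit i<r) (trans (cong (λ z → z + + coord S i * d) a₀) (ℤ.+-identityˡ _)))
  ... | no i≮4 = ℤˢ.divides (+ (coord S (11 ℕ.+ j) ℕ.+ coord U 4) - + c) (begin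
    a i                                        ≡⟨ cong a (reflect-reflect i<k) ⟨
    a (15 ℕ.+ j ∸ i′)                          ≡⟨ ℤ.neg-involutive _ ⟨
    - a′ i′                                    ≡⟨ cong -_ (L′.fit i′<r) ⟩
    - (- a (15 ℕ.+ j) + + c * E′.d)            ≡⟨ cong₂ (λ z w → - (- z + + c * w)) largest d′≡d ⟩
    - (- (a 0 + + M * d) + + c * d)            ≡⟨ cong (λ z → - (- (z + + M * d) + + c * d)) a₀ ⟩
    - (- (0ℤ + + M * d) + + c * d)             ≡⟨ eq (+ M) (+ c) d ⟩
    (+ M - + c) * d                            ∎)
    where
    open ≡-Reasoning
    i′ = 15 ℕ.+ j ∸ i
    c = coord U i′
    M = coord S (11 ℕ.+ j) ℕ.+ coord U 4
    i′<r : i′ ℕ.< r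
    i′<r = s≤s (ℕ.∸-monoʳ-≤ (15 ℕ.+ j) (ℕ.≮⇒≥ i≮4))
    eq : ∀ M c d → - (- (0ℤ + M * d) + c * d) ≡ (M - c) * d
    eq = ℤ-Ring.solve-∀

  d≡1 : d ≡ 1ℤ
  d≡1 = trans (sym (ℤ.0≤i⇒+∣i∣≡i (ℤ.<⇒≤ W.d-positive)))
    (cong +_ (∣1⇒≡1 (subst (d ℤᵘ.∣_) gcd1 (∣gcdL {d} A λ x∈ → divides-member x∈))))
    where
    divides-member : ∀ {x} → x ∈ A → d ℤᵘ.∣ x
    divides-member x∈ with ∈a x∈
    ... | i , i<k , refl = ℤˢ.∣⇒∣ᵤ (d∣a i<k)

  fit : ∀ {i} → i ℕ.< r → a i ≡ a 0 + + coord S i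
  fit {i} i<r = trans (L.fit i<r) (cong (λ z → a 0 + z) (trans (cong (λ z → + coord S i * z) d≡1) (ℤ.*-identityʳ _)))

  fit′ : ∀ {i} → i ℕ.< r → a′ i ≡ a′ 0 + + coord U i
  fit′ {i} i<r = trans (L′.fit i<r) (cong (λ z → a′ 0 + z) (trans (cong (λ z → + coord U i * z) (trans d′≡d d≡1)) (ℤ.*-identityʳ _)))

  M : ℕ
  M = coord S 4 ℕ.+ coord U 4 ℕ.+ (7 ℕ.+ j)

  aₘ : a (15 ℕ.+ j) ≡ + M
  aₘ = begin
    a (15 ℕ.+ j)                                       ≡⟨ largest ⟩
    a 0 + + (coord S (11 ℕ.+ j) ℕ.+ coord U 4) * d     ≡⟨ cong₂ (λ z w → z + + (coord S (11 ℕ.+ j) ℕ.+ coord U 4) * w) a₀ d≡1 ⟩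
    0ℤ + + (coord S (11 ℕ.+ j) ℕ.+ coord U 4) * 1ℤ     ≡⟨ trans (ℤ.+-identityˡ _) (ℤ.*-identityʳ _) ⟩
    + (coord S (11 ℕ.+ j) ℕ.+ coord U 4)               ≡⟨ cong +_ (eq (coord S 3 ℕ.+ proj₂ (proj₂ (proj₂ S))) (coord U 4) (7 ℕ.+ j)) ⟩
    + M                                                ∎
    where
    open ≡-Reasoning
    eq : ∀ s u j → s ℕ.+ j ℕ.+ u ≡ s ℕ.+ 0 ℕ.+ u ℕ.+ j
    eq = ℕ-Ring.solve-∀

  high : ∀ {i} → i ℕ.< r → a (15 ℕ.+ j ∸ i) ≡ + M - + coord U i
  high {i} i<r = begin
    a (15 ℕ.+ j ∸ i)                    ≡⟨ ℤ.neg-involutive _ ⟨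
    - a′ i                              ≡⟨ cong -_ (fit′ i<r) ⟩
    - (- a (15 ℕ.+ j) + + coord U i)    ≡⟨ cong (λ z → - (- z + + coord U i)) aₘ ⟩
    - (- + M + + coord U i)             ≡⟨ eq (+ M) (+ coord U i) ⟩
    + M - + coord U i                   ∎
    where
    open ≡-Reasoning
    eq : ∀ m u → - (- m + u) ≡ m - u
    eq = ℤ-Ring.solve-∀

  -- Each of the 7 + j inner gaps is crossed by all four indices; the weights account for the end
  -- gaps.
  spread : ℕ
  spread = 28 ℕ.+ (j ℕ.+ j ℕ.+ j ℕ.+ j) ℕ.+ (weight S ℕ.+ weight U)

  sum-spread : sum a (top r) ≡ sum a bottom + + spread
  sum-spread = begin
    a (12 ℕ.+ j) + a (13 ℕ.+ j) + a (14 ℕ.+ j) + a (15 ℕ.+ j)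
      ≡⟨ cong₂ _+_ (cong₂ _+_ (cong₂ _+_ (high {3} (ℕ.m≤m+n 4 _)) (high {2} (ℕ.m≤m+n 3 _))) (high {1} (ℕ.m≤m+n 2 _))) aₘ ⟩
    + M - + coord U 3 + (+ M - + coord U 2) + (+ M - + coord U 1) + + M
      ≡⟨ eq (+ proj₁ S) (+ proj₁ (proj₂ S)) (+ proj₁ (proj₂ (proj₂ S))) (+ proj₂ (proj₂ (proj₂ S)))
            (+ proj₁ U) (+ proj₁ (proj₂ U)) (+ proj₁ (proj₂ (proj₂ U))) (+ proj₂ (proj₂ (proj₂ U))) (+ j) ⟩
    0ℤ + (+ coord S 1) + (+ coord S 2) + (+ coord S 3) + + spread
      ≡⟨ cong (_+ + spread) (cong₂ _+_ (cong₂ _+_ (cong₂ _+_ a₀ (low (ℕ.m≤m+n 2 _)))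
           (low (ℕ.m≤m+n 3 _))) (low (ℕ.m≤m+n 4 _))) ⟨
    sum a bottom + + spread ∎
    where
    open ≡-Reasoning
    low : ∀ {i} → i ℕ.< r → a i ≡ + coord S i
    low {i} i<r = trans (fit i<r) (trans (cong (λ z → z + + coord S i) a₀) (ℤ.+-identityˡ _))
    eq : ∀ p q s t p′ q′ s′ t′ j →
      let M = p + q + s + t + + 0 + (p′ + q′ + s′ + t′ + + 0) + (+ 7 + j) in
      M - (p′ + q′ + s′) + (M - (p′ + q′)) + (M - p′) + M ≡
      0ℤ + p + (p + q) + (p + q + s) +
      (+ 28 + (j + j + j + j) + (p + (q + (q + + 0)) + (s + (s + (s + + 0))) + (t + (t + (t + (t + + 0))))
       + (p′ + (q′ + (q′ + + 0)) + (s′ + (s′ + (s′ + + 0))) + (t′ + (t′ + (t′ + (t′ + + 0)))))))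
    eq = ℤ-Ring.solve-∀

  -- All 4k - 12 sums lie among the `suc spread` integers from the least to the greatest sum.
  heavy : 23 ℕ.≤ weight S ℕ.+ weight U
  heavy = ℕ.+-cancelˡ-≤ (29 ℕ.+ 4 ℕ.* j) _ _ (begin
    29 ℕ.+ 4 ℕ.* j ℕ.+ 23         ≡⟨ eq₁ j ⟩
    52 ℕ.+ 4 ℕ.* j                ≡⟨ size ⟨
    4 ℕ.* (16 ℕ.+ j) ∸ 12         ≤⟨ interval-length card bounds ⟩
    suc spread                    ≡⟨ eq₂ j (weight S ℕ.+ weight U) ⟩
    29 ℕ.+ 4 ℕ.* j ℕ.+ (weight S ℕ.+ weight U) ∎)
    where
    open ℕ.≤-Reasoning
    bounds : ∀ {s} → Sum4 k a s → sum a bottom ≤ s × s ≤ sum a bottom + + spread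
    bounds (u , vu , refl) =
      path-≤ (Gain.path (climb mono valid-bottom vu (bottom≤ vu))) ,
      ℤ.≤-trans (path-≤ (Gain.path (climb mono vu valid-top (≤top vu)))) (ℤ.≤-reflexive sum-spread)
    eq₁ : ∀ j → 29 ℕ.+ 4 ℕ.* j ℕ.+ 23 ≡ 52 ℕ.+ 4 ℕ.* j
    eq₁ = ℕ-Ring.solve-∀
    eq₂ : ∀ j w → suc (28 ℕ.+ (j ℕ.+ j ℕ.+ j ℕ.+ j) ℕ.+ w) ≡ 29 ℕ.+ 4 ℕ.* j ℕ.+ w
    eq₂ = ℕ-Ring.solve-∀

  SU∈ : (S , U) ∈ shapePairs
  SU∈ = compatible L.shape∈ L′.shape∈ excess-sum heavy

  T : List ℕ
  T = removed j S U

  δ : ℕ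
  δ = slack S U

  M+δ : M ℕ.+ δ ≡ 18 ℕ.+ j
  M+δ = begin
    C ℕ.+ (7 ℕ.+ j) ℕ.+ (11 ∸ C)     ≡⟨ eq C (7 ℕ.+ j) (11 ∸ C) ⟩
    C ℕ.+ (11 ∸ C) ℕ.+ (7 ℕ.+ j)     ≡⟨ cong (ℕ._+ (7 ℕ.+ j)) (ℕ.m+[n∸m]≡n (shapePairs-length SU∈)) ⟩
    18 ℕ.+ j                         ∎
    where
    open ≡-Reasoning
    C = coord S 4 ℕ.+ coord U 4
    eq : ∀ x y z → x ℕ.+ y ℕ.+ z ≡ x ℕ.+ z ℕ.+ y
    eq = ℕ-Ring.solve-∀

  M≤ : M ℕ.≤ 18 ℕ.+ j
  M≤ = ℕ.m+n≤o⇒m≤o M (ℕ.≤-reflexive M+δ)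

  a≤M : ∀ {i} → i ℕ.< k → a i ≤ + M
  a≤M (s≤s i≤) = ℤ.≤-trans (mono-≤ mono i≤ ℕ.≤-refl) (ℤ.≤-reflexive aₘ)

  0≤a : ∀ {i} → i ℕ.< k → 0ℤ ≤ a i
  0≤a i<k = ℤ.≤-trans (ℤ.≤-reflexive (sym a₀)) (mono-≤ mono z≤n i<k)

  4<r : 4 ℕ.< r
  4<r = ℕ.m≤m+n 5 _

  r≤k : r ℕ.≤ k
  r≤k = ℕ.m≤n+m r 4

  C′≤M : coord U 4 ℕ.≤ M
  C′≤M = ℕ.≤-trans (ℕ.m≤n+m _ (coord S 4)) (ℕ.m≤m+n _ _)

  avoid-removed : ∀ {i h} → i ℕ.< k → h ∈ T → a i ≢ + h
  avoid-removed {i} {h} i<k h∈ e = go (removed⁻ {j} {S} {U} M+δ h∈)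
    where
    open ≡-Reasoning
    eq : ∀ x y → - x ≡ - (x + y) + y
    eq = ℤ-Ring.solve-∀
    go : h ∈ holes S ⊎ M ℕ.< h ⊎ (∃[ h′ ] (h′ ∈ holes U × h ≡ M ∸ h′)) → ⊥
    go (inj₁ h∈S) = avoid 4<r mono S fit i<k h∈S (trans e (trans (sym (ℤ.+-identityˡ (+ h))) (cong (_+ + h) (sym a₀))))
    go (inj₂ (inj₁ M<h)) = ℤ.<-irrefl e (ℤ.≤-<-trans (a≤M i<k) (ℤ.+<+ M<h))
    -- A hole at distance `h′` below the maximum is a hole of the reflected sequence.
    go (inj₂ (inj₂ (h′ , h′∈U , h≡))) = avoid 4<r mono′ U fit′ {15 ℕ.+ j ∸ i} (s≤s (ℕ.m∸n≤m (15 ℕ.+ j) i)) h′∈U (begin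
      - a (15 ℕ.+ j ∸ (15 ℕ.+ j ∸ i))   ≡⟨ cong (λ n → - a n) (reflect-reflect i<k) ⟩
      - a i                             ≡⟨ cong -_ e ⟩
      - + h                             ≡⟨ cong (λ n → - + n) h≡ ⟩
      - + (M ∸ h′)                      ≡⟨ eq (+ (M ∸ h′)) (+ h′) ⟩
      - (+ (M ∸ h′ ℕ.+ h′)) + + h′      ≡⟨ cong (λ n → - + n + + h′) (ℕ.m∸n+n≡m (ℕ.≤-trans (ℕ.<⇒≤ (hole<end U h′∈U)) C′≤M)) ⟩
      - + M + + h′                      ≡⟨ cong (λ z → - z + + h′) aₘ ⟨
      - a (15 ℕ.+ j) + + h′             ∎)

  -- Below `coord S 4` the left end decides and within distance `coord U 4` of the maximum the right
  -- end does; in between, the progression with difference 1 contains every integer.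
  attain-rest : ∀ {n} → n ∉ holes S → n ℕ.≤ M → M ∸ n ∉ holes U → + n ∈ A
  attain-rest {n} n∉S n≤M n∉U = go (n ℕ.<? coord S 4) (M ∸ n ℕ.<? coord U 4)
    where
    left : (∃[ i ] (i ℕ.< 4 × a i ≡ a 0 + + n)) → + n ∈ A
    left (i , i<4 , e) = subst (_∈ A) (trans e (trans (cong (_+ + n) a₀) (ℤ.+-identityˡ _))) (a∈ (ℕ.<-≤-trans i<4 (ℕ.m≤m+n 4 _)))
    right : (∃[ i ] (i ℕ.< 4 × a′ i ≡ a′ 0 + + (M ∸ n))) → + n ∈ A
    right (i , i<4 , e) = subst (_∈ A) (begin
      a (15 ℕ.+ j ∸ i)                   ≡⟨ ℤ.neg-involutive _ ⟨
      - a′ i                             ≡⟨ cong -_ e ⟩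
      - (- a (15 ℕ.+ j) + + (M ∸ n))     ≡⟨ cong (λ z → - (- z + + (M ∸ n))) aₘ ⟩
      - (- + M + + (M ∸ n))              ≡⟨ cong (λ m → - (- + m + + (M ∸ n))) (ℕ.m∸n+n≡m n≤M) ⟨
      - (- + (M ∸ n ℕ.+ n) + + (M ∸ n))  ≡⟨ eq (+ (M ∸ n)) (+ n) ⟩
      + n                                ∎) (a∈ (s≤s (ℕ.m∸n≤m (15 ℕ.+ j) i)))
      where
      open ≡-Reasoning
      eq : ∀ x y → - (- (x + y) + x) ≡ y
      eq = ℤ-Ring.solve-∀
    inner : coord S 4 ℕ.≤ n → coord U 4 ℕ.≤ M ∸ n → + n ∈ A
    inner C≤n C′≤ = subst (_∈ A)
      (trans (fit {4 ℕ.+ x} x<) (trans (cong (_+ + coord S (4 ℕ.+ x)) a₀) (trans (ℤ.+-identityˡ _) (cong +_ c≡n))))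
      (a∈ (ℕ.<-≤-trans x< r≤k))
      where
      x = n ∸ coord S 4
      c≡n : coord S (4 ℕ.+ x) ≡ n
      c≡n = trans (cong (ℕ._+ x) (sym (ℕ.+-identityʳ (coord S 3 ℕ.+ proj₂ (proj₂ (proj₂ S)))))) (ℕ.m+[n∸m]≡n C≤n)
      eq : ∀ s u x → s ℕ.+ u ℕ.+ x ≡ s ℕ.+ x ℕ.+ u
      eq = ℕ-Ring.solve-∀
      x≤ : x ℕ.≤ 7 ℕ.+ j
      x≤ = ℕ.+-cancelˡ-≤ (coord S 4 ℕ.+ coord U 4) x (7 ℕ.+ j) (begin
        coord S 4 ℕ.+ coord U 4 ℕ.+ x   ≡⟨ eq (coord S 4) (coord U 4) x ⟩
        coord S 4 ℕ.+ x ℕ.+ coord U 4   ≡⟨ cong (ℕ._+ coord U 4) (ℕ.m+[n∸m]≡n C≤n) ⟩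
        n ℕ.+ coord U 4                 ≤⟨ ℕ.+-monoʳ-≤ n C′≤ ⟩
        n ℕ.+ (M ∸ n)                   ≡⟨ ℕ.m+[n∸m]≡n n≤M ⟩
        M                               ∎)
        where open ℕ.≤-Reasoning
      x< : 4 ℕ.+ x ℕ.< r
      x< = ℕ.+-monoʳ-≤ 5 x≤
    go : Dec (n ℕ.< coord S 4) → Dec (M ∸ n ℕ.< coord U 4) → + n ∈ A
    go (yes n<) _       = left (attain 4<r mono S fit n< n∉S)
    go (no _)  (yes n<) = right (attain 4<r mono′ U fit′ n< n∉U)
    go (no n≮) (no n≮′) = inner (ℕ.≮⇒≥ n≮) (ℕ.≮⇒≥ n≮′)

  k+2 : k ℕ.+ 2 ≡ 18 ℕ.+ j
  k+2 = ℕ.+-comm k 2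

  interval-minus : IsIntervalMinus k A (map +_ T)
  interval-minus n = mk⇔ to from
    where
    to : n ∈ A → (0ℤ ≤ n × n ≤ + k + + 2) × n ∉ map +_ T
    to n∈ = go (∈a n∈)
      where
      go : (∃[ i ] (i ℕ.< k × n ≡ a i)) → (0ℤ ≤ n × n ≤ + k + + 2) × n ∉ map +_ T
      go (i , i<k , e) = (subst (0ℤ ≤_) (sym e) (0≤a i<k) , subst (_≤ + k + + 2) (sym e) (ℤ.≤-trans (a≤M i<k) M≤k+2)) , out
        where
        M≤k+2 : + M ≤ + k + + 2
        M≤k+2 = ℤ.+≤+ (ℕ.≤-trans M≤ (ℕ.≤-reflexive (sym k+2)))
        hit : (∃[ h ] (h ∈ T × n ≡ + h)) → ⊥
        hit (h , h∈ , e′) = avoid-removed i<k h∈ (trans (sym e) e′)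
        out : n ∉ map +_ T
        out n∈T = hit (∈-map⁻ +_ n∈T)
    from : (0ℤ ≤ n × n ≤ + k + + 2) × n ∉ map +_ T → n ∈ A
    from ((ℤ.+≤+ {n = m} _ , ℤ.+≤+ m≤) , m∉) =
      go (removed⁺ {j} {S} {U} M+δ (ℕ.≤-trans m≤ (ℕ.≤-reflexive k+2)) (λ m∈ → m∉ (∈-map⁺ +_ m∈)))
      where
      go : m ∉ holes S × m ℕ.≤ M × M ∸ m ∉ holes U → + m ∈ A
      go (∉S , ≤M , ∉U) = attain-rest ∉S ≤M ∉U

  conclusion : ∃[ T ] (T ∈ triples k × IsIntervalMinus k A T)
  conclusion = map +_ T , removed-triple j SU∈ , interval-minus

theorem1p14 : (k : ℕ) → 16 ℕ.≤ k → (A : List ℤ) → Unique A → length A ≡ k →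
    MinIsZero A → gcdL A ≡ 1ℤ → Card4Sumset A (4 ℕ.* k ∸ 12) →
    ∃[ T ] (T ∈ triples k × IsIntervalMinus k A T)
theorem1p14 k 16≤k A uA len min0 gcd1 card = go (ℕ.m≤n⇒∃[o]m+o≡n 16≤k) len card
  where
  go : ∀ {k} → (∃[ j ] 16 ℕ.+ j ≡ k) → length A ≡ k → Card4Sumset A (4 ℕ.* k ∸ 12) →
       ∃[ T ] (T ∈ triples k × IsIntervalMinus k A T)
  go (j , refl) len card = Extremal.conclusion j uA len min0 gcd1 card
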